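{- Let $n,k\ge 1$ be integers, let $\mathbb F$ be a field, and let $X=(x_{i\,j})$ be an $n\times k$ matrix whose entries are the indeterminates $x_{1\,1},\ldots,x_{n\,k}$ over $\mathbb F$. Suppose $n\ge k$. Then the following equality holds in $\mathbb F[x_{1\,1},\ldots,x_{n\,k}]$: \[ \det_{n\,k}(X)=\begin{cases} (-1)^{1+2+\cdots+k}\,\mathrm{pf}\left(X^t\mathbf D^{(n)}X\right), & k \text{ even},\\ (-1)^{1+2+\cdots+(k+1)}\,\mathrm{pf}\left((X')^t\mathbf D^{(n)}X'\right), & k \text{ odd},\ n\text{ even},\\ (-1)^{1+2+\cdots+(k+1)}\,\mathrm{pf}\left((X'')^t\mathbf D^{(n+1)}X''\right), & k \text{ odd},\ n\text{ odd}, \end{cases} \] where $X'$ is the $n\times(k+1)$ matrix obtained from $X$ by appending a last column all of whose entries equal $1$, and $X''$ is the $(n+1)\times(k+1)$ matrix obtained from $X'$ by appending a last row $(0,\ldots,0,1)$. If instead $n<k$, then the same equality (with the roles of $n$ and $k$ interchanged) holds for $\det_{k\,n}(X^t)$, which by definition equals $\det_{n\,k}(X)$.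
   Context: For a tuple $(c_1,\ldots,c_n)$ of natural numbers ($n\ge2$), $\mathrm{sgn}(c_1,\ldots,c_n)=0$ if $c_i=c_j$ for some $i<j$, and otherwise $\mathrm{sgn}(c_1,\ldots,c_n)=(-1)^{|\{(i,j):1\le i<j\le n,\ c_i>c_j\}|}$. The matrix $\mathbf D^{(n)}=(d^{(n)}_{i\,j})$ is the $n\times n$ matrix with $d^{(n)}_{i\,j}=(-1)^{i+j}\mathrm{sgn}(i,j)$ for $1\le i,j\le n$ (entries interpreted in $\mathbb F$). Cullis' determinant: for $n\ge k\ge1$ and an $n\times k$ matrix $X=(x_{i\,j})$, \[\det_{n\,k}(X)=(-1)^{1+\cdots+k}\sum_{1\le c_1<\cdots<c_k\le n}(-1)^{c_1+\cdots+c_k}\det\bigl(x_{c_a\,b}\bigr)_{1\le a,b\le k},\] and for $k>n$, $\det_{n\,k}(X)=\det_{k\,n}(X^t)$. Pfaffian: $\Pi_{2m}\subseteq S_{2m}$ is the set of permutations $\pi$ with $\pi(1)<\pi(3)<\cdots<\pi(2m-1)$ and $\pi(2l-1)<\pi(2l)$ for all $1\le l\le m$; for a skew-symmetric $2m\times 2m$ matrix $Y=(y_{i\,j})$, $\mathrm{pf}(Y)=\sum_{\pi\in\Pi_{2m}}\mathrm{sgn}(\pi)\prod_{l=1}^m y_{\pi(2l-1)\,\pi(2l)}$, where $\mathrm{sgn}(\pi)$ is the sign of the permutation. -}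

module Defs where

open import Level using (Level; _⊔_)
open import Data.Nat using (ℕ; zero; suc; _<ᵇ_; _≡ᵇ_; _≤?_)
import Data.Nat as ℕ
open import Data.Bool using (Bool; true; false; _∧_; _∨_; not; if_then_else_)
open import Data.Fin using (Fin; zero; suc; toℕ)
open import Data.List using (List; []; _∷_; map; foldr; concatMap; allFin; length)
open import Data.Maybe using (Maybe; just; nothing)
import Data.Maybe as Maybe
open import Data.Product using (_×_; _,_; ∃)
open import Relation.Nullary using (yes; no)
open import Relation.Nullary.Decidable using (does)
open import Relation.Binary.PropositionalEquality using (_≡_)
open import Algebra.Bundles using (CommutativeRing)

allFuns : (m N : ℕ) → List (Fin m → Fin N)
allFuns zero    N = (λ ()) ∷ []
allFuns (suc m) N =
  concatMap (λ f → map (λ a → λ { zero → a ; (suc i) → f i }) (allFin N)) (allFuns m N)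

tuple : ∀ {m N} → (Fin m → Fin N) → List ℕ
tuple {m} f = map (λ i → toℕ (f i)) (allFin m)

filterᵇ : ∀ {A : Set} → (A → Bool) → List A → List A
filterᵇ p []       = []
filterᵇ p (x ∷ xs) = if p x then x ∷ filterᵇ p xs else filterᵇ p xs

inversions : List ℕ → ℕ
inversions []       = 0
inversions (x ∷ xs) = length (filterᵇ (λ y → y <ᵇ x) xs) ℕ.+ inversions xs

hasRepeat : List ℕ → Bool
hasRepeat []       = false
hasRepeat (x ∷ xs) = foldr (λ y b → (y ≡ᵇ x) ∨ b) false xs ∨ hasRepeat xs

isEven : ℕ → Bool
isEven zero          = true
isEven (suc zero)    = false
isEven (suc (suc n)) = isEven n

tri : ℕ → ℕ
tri zero    = 0
tri (suc k) = suc k ℕ.+ tri k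

increasing : List ℕ → Bool
increasing []           = true
increasing (x ∷ [])     = true
increasing (x ∷ y ∷ xs) = (x <ᵇ y) ∧ increasing (y ∷ xs)

pairs : ∀ {A : Set} → List A → List (A × A)
pairs []           = []
pairs (x ∷ [])     = []
pairs (x ∷ y ∷ xs) = (x , y) ∷ pairs xs

isPerm : ∀ {N} → (Fin N → Fin N) → Bool
isPerm f = not (hasRepeat (tuple f))

inΠ : ∀ {N} → (Fin N → Fin N) → Bool
inΠ f = isPerm f
      ∧ increasing (map (λ p → Data.Product.proj₁ p) (pairs (tuple f)))
      ∧ foldr (λ p b → (Data.Product.proj₁ p <ᵇ Data.Product.proj₂ p) ∧ b) true (pairs (tuple f))

unsnoc : ∀ {k} → Fin (suc k) → Maybe (Fin k)
unsnoc {zero}  zero    = nothing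
unsnoc {suc k} zero    = just zero
unsnoc {suc k} (suc i) = Maybe.map suc (unsnoc i)

module _ {c ℓ} (R : CommutativeRing c ℓ) where
  open CommutativeRing R

  Mat : ℕ → ℕ → Set c
  Mat m n = Fin m → Fin n → Carrier

  transpose : ∀ {m n} → Mat m n → Mat n m
  transpose X i j = X j i

  _·_ : ∀ {m n p} → Mat m n → Mat n p → Mat m p
  _·_ {n = n} A B i j = foldr _+_ 0# (map (λ l → A i l * B l j) (allFin n))

  Σ-list : ∀ {A : Set} → List A → (A → Carrier) → Carrier
  Σ-list xs f = foldr (λ a s → f a + s) 0# xs

  Π-list : ∀ {A : Set} → List A → (A → Carrier) → Carrier
  Π-list xs f = foldr (λ a s → f a * s) 1# xs

  sign : ℕ → Carrier
  sign e = if isEven e then 1# else - 1#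

  sgn : List ℕ → Carrier
  sgn cs = if hasRepeat cs then 0# else sign (inversions cs)

  -- D^{(n)} with d_{ij} = (-1)^{i+j} sgn(i,j), indices 1-based
  D : (n : ℕ) → Mat n n
  D n i j = sign (suc (toℕ i) ℕ.+ suc (toℕ j)) * sgn (suc (toℕ i) ∷ suc (toℕ j) ∷ [])

  det : ∀ {k} → Mat k k → Carrier
  det {k} A = Σ-list (filterᵇ isPerm (allFuns k k))
                     (λ σ → sgn (tuple σ) * Π-list (allFin k) (λ i → A i (σ i)))

  -- Cullis' determinant for an n×k matrix, the defining formula (meant for n ≥ k):
  -- (-1)^{1+⋯+k} Σ_{c₁<⋯<c_k} (-1)^{c₁+⋯+c_k} det(x_{c_a b})   (1-based cᵢ)
  cullisFormula : (n k : ℕ) → Mat n k → Carrier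
  cullisFormula n k X =
    sign (tri k) *
    Σ-list (filterᵇ (λ c → increasing (tuple c)) (allFuns k n))
      (λ c → sign (foldr ℕ._+_ 0 (map suc (tuple c))) * det (λ a b → X (c a) b))

  cullis : (n k : ℕ) → Mat n k → Carrier
  cullis n k X with k ≤? n
  ... | yes _ = cullisFormula n k X
  ... | no  _ = cullisFormula k n (transpose X)

  -- Pfaffian: Σ_{π ∈ Π_N} sgn(π) ∏_l y_{π(2l-1) π(2l)}  (used for N even)
  pf : ∀ {N} → Mat N N → Carrier
  pf {N} Y = Σ-list (filterᵇ inΠ (allFuns N N))
    (λ π → sgn (tuple π) *
           Π-list (pairs (map π (allFin N))) (λ p → Y (Data.Product.proj₁ p) (Data.Product.proj₂ p)))

  X′ : ∀ {n k} → Mat n k → Mat n (suc k)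
  X′ X i j with unsnoc j
  ... | just j′ = X i j′
  ... | nothing = 1#

  X″ : ∀ {n k} → Mat n k → Mat (suc n) (suc k)
  X″ X i j with unsnoc i | unsnoc j
  ... | just i′ | _       = X′ X i′ j
  ... | nothing | just _  = 0#
  ... | nothing | nothing = 1#

  gram : ∀ {n k} → Mat n k → Mat k k
  gram {n} B = (transpose B · D n) · B

  PfaffianIdentity : (N K : ℕ) → Carrier → Mat N K → Set ℓ
  PfaffianIdentity N K d X =
      (isEven K ≡ true → d ≈ sign (tri K) * pf (gram X))
    × (isEven K ≡ false → isEven N ≡ true  → d ≈ sign (tri (suc K)) * pf (gram (X′ X)))
    × (isEven K ≡ false → isEven N ≡ false → d ≈ sign (tri (suc K)) * pf (gram (X″ X)))

{-# OPTIONS --safe #-}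
module Submission where

-- Regard a function on lists of column indices as a form, and let a covector x act on forms
-- by Laplace expansion, x ⋏ G; these operators anticommute and square to zero.  Both sides
-- of the identity are built by adding the rows of X one at a time, starting from the last:
--   * the signed sum F of the maximal minors becomes ± (F + x ⋏ F) when a row x is added;
--   * Xᵗ D X changes by x uᵗ − u xᵗ, with u the alternating sum of the later rows, so that its
--     Pfaffian changes by x ⋏ u ⋏ pf.
-- These agree in even degree because u ⋏ F = F in odd degree (and 0 in even degree).
-- For k odd, expanding along the last column of X′ gives an alternating sum of n − k equal terms;
-- X″ is X′ for the matrix X extended by a zero row, which does not change F.

open import Defs
open import Algebra.Bundles using (CommutativeRing)
open import Data.Bool using (Bool; true; false; if_then_else_; not; _∨_; _∧_)
open import Data.Bool.Properties using (T-≡; ∧-zeroʳ)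
open import Data.Fin using (Fin; zero; suc; toℕ; inject₁; fromℕ) renaming (_<_ to _<ᶠ_)
open import Data.Integer using (ℤ; +_; -[1+_]; _⊖_; -1ℤ)
import Data.Integer as ℤ
import Data.Integer.Properties as ℤₚ
open import Data.List using (List; []; _∷_; [_]; _++_; _ʳ++_; allFin; concatMap; foldr; length; map; tabulate)
open import Data.List.Membership.Propositional using (_∈_)
open import Data.List.Properties using (length-++; length-map; length-tabulate; length-ʳ++; map-tabulate)
open import Data.List.Relation.Unary.All as All using (All; []; _∷_)
open import Data.List.Relation.Unary.AllPairs using (AllPairs; []; _∷_)
open import Data.List.Relation.Unary.AllPairs.Properties using (tabulate⁺-<)
open import Data.List.Relation.Unary.Any using (here; there)
open import Data.Maybe using (just; nothing; maybe′)
import Data.Maybe as Maybe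
open import Data.Nat using (ℕ; zero; suc; _<_; _≤_; _<ᵇ_; _≡ᵇ_; _≤?_; s≤s)
import Data.Nat as ℕ
open import Data.Nat.Properties using (suc-injective; +-suc; ≡⇒≡ᵇ; ≡ᵇ⇒≡; <⇒<ᵇ; <ᵇ⇒<; <⇒≢; <⇒≯; <⇒≤; <-irrefl; <-trans)
import Data.Nat.Properties as ℕₚ
open import Data.Product using (_×_; _,_; proj₁; proj₂; ∃; ∃₂)
open import Data.Vec as Vec using (Vec; []; _∷_; toList)
open import Data.Vec.Properties using (length-toList; map-∘; tabulate-∘)
import Data.Vec.Relation.Unary.All as VecAll
open import Function using (_∘_; id)
open import Function.Bundles using (Equivalence)
open import Relation.Binary.PropositionalEquality as ≡ using (_≡_; _≢_)
import Relation.Binary.Reasoning.Setoid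
open import Relation.Nullary using (¬_; contradiction; yes; no)
open import Relation.Nullary.Decidable using (dec⇒maybe)

-- The determinant, Cullis' sum and the Pfaffian are given as sums over functions, with signs
-- counted by inversions and side conditions tested by Booleans, while `⋏` acts on forms on lists of
-- columns. The bridge is to write `sgn` as a product over pairs of letters, with factor zero on
-- equal letters. The factors that involve a chosen letter are absorbed into the remaining rows (for
-- determinants) or into the matrix entries (for Pfaffians). The absorbed factor vanishes at the
-- chosen letter, which may therefore be struck from the list; on an ascending list the other
-- factors multiply to the sign of a Laplace expansion. A rank-two change adds a single term to the
-- Pfaffian because Pfaffians are divided powers of a 2-form and the 2-form of `x` and `u` squares
-- to zero. Nothing is ever divided, so the argument works over any commutative ring, in particular
-- over polynomial rings in characteristic 2.

module IntegerCoefficients {c ℓ} (R : CommutativeRing c ℓ) where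
  open CommutativeRing R hiding (zero)
  open import Algebra.Properties.Ring ring using (-0#≈0#; -‿involutive; -‿+-comm; -‿distribˡ-*; -‿distribʳ-*)
  open import Algebra.Properties.Semiring.Mult.TCOptimised semiring using (1+×; ×-homo-+; ×1-homo-*) renaming (_×_ to _×ᵣ_)
  open import Algebra.Solver.Ring.AlmostCommutativeRing using (fromCommutativeRing; _-Raw-AlmostCommutative⟶_)
  open Relation.Binary.Reasoning.Setoid setoid

  -- Equality in `R` need not be decidable, so the polynomial solver compares coefficients in `ℤ`
  -- and reads them in `R` along the canonical homomorphism.
  ⟦_⟧ℤ : ℤ → Carrier
  ⟦ + n ⟧ℤ      = n ×ᵣ 1#
  ⟦ -[1+ n ] ⟧ℤ = - (suc n ×ᵣ 1#)

  -‿homo : ∀ i → ⟦ ℤ.- i ⟧ℤ ≈ - ⟦ i ⟧ℤ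
  -‿homo (+ zero)  = sym -0#≈0#
  -‿homo (+ suc n) = refl
  -‿homo -[1+ n ]  = sym (-‿involutive _)

  cancel-1 : ∀ a b → (1# + a) - (1# + b) ≈ a - b
  cancel-1 a b = begin
    (1# + a) + - (1# + b)    ≈⟨ +-cong (+-comm 1# a) (sym (-‿+-comm 1# b)) ⟩
    (a + 1#) + (- 1# + - b)  ≈⟨ +-assoc a 1# _ ⟩
    a + (1# + (- 1# + - b))  ≈⟨ +-congˡ (+-assoc 1# _ _) ⟨
    a + ((1# + - 1#) + - b)  ≈⟨ +-congˡ (+-congʳ (-‿inverseʳ 1#)) ⟩
    a + (0# + - b)           ≈⟨ +-congˡ (+-identityˡ _) ⟩
    a - b                    ∎

  ⊖-homo : ∀ m n → ⟦ m ⊖ n ⟧ℤ ≈ m ×ᵣ 1# - n ×ᵣ 1#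
  ⊖-homo m       zero    = sym (trans (+-congˡ -0#≈0#) (+-identityʳ _))
  ⊖-homo zero    (suc n) = sym (+-identityˡ _)
  ⊖-homo (suc m) (suc n) = begin
    ⟦ suc m ⊖ suc n ⟧ℤ                 ≡⟨ ≡.cong ⟦_⟧ℤ (ℤₚ.[1+m]⊖[1+n]≡m⊖n m n) ⟩
    ⟦ m ⊖ n ⟧ℤ                         ≈⟨ ⊖-homo m n ⟩
    m ×ᵣ 1# - n ×ᵣ 1#                    ≈⟨ cancel-1 _ _ ⟨
    (1# + m ×ᵣ 1#) - (1# + n ×ᵣ 1#)      ≈⟨ +-cong (1+× m 1#) (-‿cong (1+× n 1#)) ⟨
    suc m ×ᵣ 1# - suc n ×ᵣ 1#            ∎

  +-homo : ∀ i j → ⟦ i ℤ.+ j ⟧ℤ ≈ ⟦ i ⟧ℤ + ⟦ j ⟧ℤ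
  +-homo (+ m)    (+ n)    = ×-homo-+ 1# m n
  +-homo (+ m)    -[1+ n ] = ⊖-homo m (suc n)
  +-homo -[1+ m ] (+ n)    = trans (⊖-homo n (suc m)) (+-comm _ _)
  +-homo -[1+ m ] -[1+ n ] = begin
    - (suc (suc (m ℕ.+ n)) ×ᵣ 1#)         ≡⟨ ≡.cong (λ k → - (suc k ×ᵣ 1#)) (+-suc m n) ⟨
    - ((suc m ℕ.+ suc n) ×ᵣ 1#)           ≈⟨ -‿cong (×-homo-+ 1# (suc m) (suc n)) ⟩
    - (suc m ×ᵣ 1# + suc n ×ᵣ 1#)          ≈⟨ -‿+-comm _ _ ⟨
    - (suc m ×ᵣ 1#) + - (suc n ×ᵣ 1#)      ∎

  *-homo₊ : ∀ m j → ⟦ + m ℤ.* j ⟧ℤ ≈ m ×ᵣ 1# * ⟦ j ⟧ℤ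
  *-homo₊ m (+ n) = begin
    ⟦ + m ℤ.* + n ⟧ℤ   ≡⟨ ≡.cong ⟦_⟧ℤ (ℤₚ.pos-* m n) ⟨
    (m ℕ.* n) ×ᵣ 1#     ≈⟨ ×1-homo-* m n ⟩
    m ×ᵣ 1# * n ×ᵣ 1#  ∎
  *-homo₊ m -[1+ n ] = begin
    ⟦ + m ℤ.* -[1+ n ] ⟧ℤ         ≡⟨ ≡.cong ⟦_⟧ℤ (ℤₚ.neg-distribʳ-* (+ m) (+ suc n)) ⟨
    ⟦ ℤ.- (+ m ℤ.* + suc n) ⟧ℤ    ≈⟨ -‿homo (+ m ℤ.* + suc n) ⟩
    - ⟦ + m ℤ.* + suc n ⟧ℤ        ≈⟨ -‿cong (*-homo₊ m (+ suc n)) ⟩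
    - (m ×ᵣ 1# * suc n ×ᵣ 1#)       ≈⟨ -‿distribʳ-* _ _ ⟩
    m ×ᵣ 1# * - (suc n ×ᵣ 1#)       ∎

  *-homo : ∀ i j → ⟦ i ℤ.* j ⟧ℤ ≈ ⟦ i ⟧ℤ * ⟦ j ⟧ℤ
  *-homo (+ m)    j = *-homo₊ m j
  *-homo -[1+ m ] j = begin
    ⟦ -[1+ m ] ℤ.* j ⟧ℤ           ≡⟨ ≡.cong ⟦_⟧ℤ (ℤₚ.neg-distribˡ-* (+ suc m) j) ⟨
    ⟦ ℤ.- (+ suc m ℤ.* j) ⟧ℤ      ≈⟨ -‿homo (+ suc m ℤ.* j) ⟩
    - ⟦ + suc m ℤ.* j ⟧ℤ          ≈⟨ -‿cong (*-homo₊ (suc m) j) ⟩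
    - (suc m ×ᵣ 1# * ⟦ j ⟧ℤ)       ≈⟨ -‿distribˡ-* _ _ ⟩
    - (suc m ×ᵣ 1#) * ⟦ j ⟧ℤ       ∎

  homomorphism : ℤ.+-*-rawRing -Raw-AlmostCommutative⟶ fromCommutativeRing R
  homomorphism = record
    { ⟦_⟧ = ⟦_⟧ℤ ; +-homo = +-homo ; *-homo = *-homo ; -‿homo = -‿homo ; 0-homo = refl ; 1-homo = refl }

  open import Algebra.Solver.Ring ℤ.+-*-rawRing (fromCommutativeRing R) homomorphism
    (λ i j → Maybe.map (λ eq → reflexive (≡.cong ⟦_⟧ℤ eq)) (dec⇒maybe (i ℤ.≟ j))) public
    using (solve; _:=_; _:+_; _:*_; _:-_; :-_; con)

-- Covectors acting on forms

module Exterior {c ℓ} (R : CommutativeRing c ℓ) where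
  open CommutativeRing R hiding (zero)
  open IntegerCoefficients R
  open Relation.Binary.Reasoning.Setoid setoid

  infixr 7 _⋏_

  _⋏_ : ∀ {J : Set} → (J → Carrier) → (List J → Carrier) → List J → Carrier
  (x ⋏ G) []       = 0#
  (x ⋏ G) (j ∷ js) = x j * G js - (x ⋏ (G ∘ (j ∷_))) js

  -- The exterior unit: applying m covectors to it by `⋏` gives the form whose value on m columns is
  -- the minor of these rows.
  δ : ∀ {J : Set} → List J → Carrier
  δ []      = 1#
  δ (_ ∷ _) = 0#

  module _ {J : Set} where

    -- Laplace expansion evaluates `G` only on lists one letter shorter, and many identities between
    -- forms used later hold in a single degree only.
    ⋏-cong-length : ∀ {x y : J → Carrier} {G H} js → (∀ j → x j ≈ y j) →
      (∀ t → suc (length t) ≡ length js → G t ≈ H t) → (x ⋏ G) js ≈ (y ⋏ H) js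
    ⋏-cong-length []       p q = refl
    ⋏-cong-length (j ∷ js) p q =
      +-cong (*-cong (p j) (q js ≡.refl))
             (-‿cong (⋏-cong-length js p (λ t e → q (j ∷ t) (≡.cong suc e))))

    ⋏-cong : ∀ {x y : J → Carrier} {G H} js → (∀ j → x j ≈ y j) → (∀ t → G t ≈ H t) →
      (x ⋏ G) js ≈ (y ⋏ H) js
    ⋏-cong js p q = ⋏-cong-length js p (λ t _ → q t)

    ⋏-congʳ : ∀ (x : J → Carrier) {G H} js → (∀ t → G t ≈ H t) → (x ⋏ G) js ≈ (x ⋏ H) js
    ⋏-congʳ x js = ⋏-cong js (λ _ → refl)

    ⋏-+ˡ : ∀ (x y : J → Carrier) G js → ((λ j → x j + y j) ⋏ G) js ≈ (x ⋏ G) js + (y ⋏ G) js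
    ⋏-+ˡ x y G []       = sym (+-identityˡ 0#)
    ⋏-+ˡ x y G (j ∷ js) = trans (+-congˡ (-‿cong (⋏-+ˡ x y _ js)))
      (solve 5 (λ a b g p q → (a :+ b) :* g :- (p :+ q) := (a :* g :- p) :+ (b :* g :- q)) refl _ _ _ _ _)

    ⋏-+ʳ : ∀ (x : J → Carrier) G H js → (x ⋏ (λ t → G t + H t)) js ≈ (x ⋏ G) js + (x ⋏ H) js
    ⋏-+ʳ x G H []       = sym (+-identityˡ 0#)
    ⋏-+ʳ x G H (j ∷ js) = trans (+-congˡ (-‿cong (⋏-+ʳ x _ _ js)))
      (solve 5 (λ a g h p q → a :* (g :+ h) :- (p :+ q) := (a :* g :- p) :+ (a :* h :- q)) refl _ _ _ _ _)

    ⋏-*ˡ : ∀ r (x : J → Carrier) G js → ((λ j → r * x j) ⋏ G) js ≈ r * (x ⋏ G) js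
    ⋏-*ˡ r x G []       = sym (zeroʳ r)
    ⋏-*ˡ r x G (j ∷ js) = trans (+-congˡ (-‿cong (⋏-*ˡ r x _ js)))
      (solve 4 (λ r a g p → (r :* a) :* g :- r :* p := r :* (a :* g :- p)) refl _ _ _ _)

    ⋏-*ʳ : ∀ r (x : J → Carrier) G js → (x ⋏ (λ t → r * G t)) js ≈ r * (x ⋏ G) js
    ⋏-*ʳ r x G []       = sym (zeroʳ r)
    ⋏-*ʳ r x G (j ∷ js) = trans (+-congˡ (-‿cong (⋏-*ʳ r x _ js)))
      (solve 4 (λ r a g p → a :* (r :* g) :- r :* p := r :* (a :* g :- p)) refl _ _ _ _)

    ⋏-0ˡ : ∀ (G : List J → Carrier) js → ((λ _ → 0#) ⋏ G) js ≈ 0#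
    ⋏-0ˡ G []       = refl
    ⋏-0ˡ G (j ∷ js) = trans (+-congˡ (-‿cong (⋏-0ˡ _ js)))
      (solve 1 (λ g → con (+ 0) :* g :- con (+ 0) := con (+ 0)) refl _)

    ⋏-0ʳ : ∀ (x : J → Carrier) js → (x ⋏ (λ _ → 0#)) js ≈ 0#
    ⋏-0ʳ x []       = refl
    ⋏-0ʳ x (j ∷ js) = trans (+-congˡ (-‿cong (⋏-0ʳ x js)))
      (solve 1 (λ g → g :* con (+ 0) :- con (+ 0) := con (+ 0)) refl _)

    -- Prescribing the first column is contraction with a basis vector, an antiderivation for `⋏`;
    -- its product rule on `y ⋏ G` is pushed through `x ⋏_` by linearity.
    ⋏-∷ : ∀ (x y : J → Carrier) G j js →
      (x ⋏ ((y ⋏ G) ∘ (j ∷_))) js ≈ y j * (x ⋏ G) js - (x ⋏ (y ⋏ (G ∘ (j ∷_)))) js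
    ⋏-∷ x y G j js = begin
      (x ⋏ (λ t → y j * G t + - (y ⋏ (G ∘ (j ∷_))) t)) js
        ≈⟨ ⋏-congʳ x js (λ t → solve 3 (λ a g p → a :* g :- p := a :* g :+ con -1ℤ :* p) refl (y j) (G t) _) ⟩
      (x ⋏ (λ t → y j * G t + - 1# * (y ⋏ (G ∘ (j ∷_))) t)) js
        ≈⟨ ⋏-+ʳ x _ _ js ⟩
      (x ⋏ (λ t → y j * G t)) js + (x ⋏ (λ t → - 1# * (y ⋏ (G ∘ (j ∷_))) t)) js
        ≈⟨ +-cong (⋏-*ʳ _ x _ js) (⋏-*ʳ _ x _ js) ⟩
      y j * (x ⋏ G) js + - 1# * (x ⋏ (y ⋏ (G ∘ (j ∷_)))) js
        ≈⟨ solve 3 (λ a g p → a :* g :+ con -1ℤ :* p := a :* g :- p) refl _ _ _ ⟩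
      y j * (x ⋏ G) js - (x ⋏ (y ⋏ (G ∘ (j ∷_)))) js ∎

    -- Proved directly, since anticommutativity only makes twice this form zero, which says nothing
    -- in characteristic 2.
    ⋏-self : ∀ (x : J → Carrier) G js → (x ⋏ (x ⋏ G)) js ≈ 0#
    ⋏-self x G []       = refl
    ⋏-self x G (j ∷ js) = begin
      x j * (x ⋏ G) js - (x ⋏ ((x ⋏ G) ∘ (j ∷_))) js
        ≈⟨ +-congˡ (-‿cong (trans (⋏-∷ x x G j js) (+-congˡ (-‿cong (⋏-self x _ js))))) ⟩
      x j * (x ⋏ G) js - (x j * (x ⋏ G) js - 0#)
        ≈⟨ solve 1 (λ a → a :- (a :- con (+ 0)) := con (+ 0)) refl _ ⟩
      0# ∎

    ⋏-anticomm : ∀ (x y : J → Carrier) G js → (x ⋏ (y ⋏ G)) js ≈ - (y ⋏ (x ⋏ G)) js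
    ⋏-anticomm x y G []       = solve 0 (con (+ 0) := :- con (+ 0)) refl
    ⋏-anticomm x y G (j ∷ js) = begin
      x j * (y ⋏ G) js - (x ⋏ ((y ⋏ G) ∘ (j ∷_))) js
        ≈⟨ +-congˡ (-‿cong (trans (⋏-∷ x y G j js) (+-congˡ (-‿cong (⋏-anticomm x y _ js))))) ⟩
      x j * (y ⋏ G) js - (y j * (x ⋏ G) js - - (y ⋏ (x ⋏ (G ∘ (j ∷_)))) js)
        ≈⟨ solve 3 (λ a b p → a :- (b :- :- p) := :- (b :- (a :- p))) refl _ _ _ ⟩
      - (y j * (x ⋏ G) js - (x j * (y ⋏ G) js - (y ⋏ (x ⋏ (G ∘ (j ∷_)))) js))
        ≈⟨ -‿cong (+-congˡ (-‿cong (⋏-∷ y x G j js))) ⟨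
      - (y j * (x ⋏ G) js - (y ⋏ ((x ⋏ G) ∘ (j ∷_))) js) ∎

    -- A scalar that depends only on the degree is constant on the lists reached by one expansion;
    -- `h′` is `h` reindexed by the degree of the product.
    ⋏-graded : ∀ (h h′ : ℕ → Carrier) (x : J → Carrier) G js → (∀ n → h n ≈ h′ (suc n)) →
      (x ⋏ (λ t → h (length t) * G t)) js ≈ h′ (length js) * (x ⋏ G) js
    ⋏-graded h h′ x G js e = trans
      (⋏-cong-length js (λ _ → refl)
        (λ t p → *-congʳ (trans (e (length t)) (reflexive (≡.cong h′ p)))))
      (⋏-*ʳ _ x G js)

    -- In each term of the expansion the weight of the removed column comes from the covector and
    -- those of the other columns from the form, so every term carries the full product.
    ⋏-weight : ∀ (w x : J → Carrier) G js →
      ((λ j → w j * x j) ⋏ (λ t → Π-list R t w * G t)) js ≈ Π-list R js w * (x ⋏ G) js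
    ⋏-weight w x G []       = sym (zeroʳ _)
    ⋏-weight w x G (j ∷ js) = begin
      (w j * x j) * (W * G js) - ((λ i → w i * x i) ⋏ (λ t → w j * Π-list R t w * G (j ∷ t))) js
        ≈⟨ +-congˡ (-‿cong (trans (⋏-congʳ _ js (λ t → *-assoc _ _ _))
             (trans (⋏-*ʳ (w j) _ _ js) (*-congˡ (⋏-weight w x _ js))))) ⟩
      (w j * x j) * (W * G js) - w j * (W * (x ⋏ (G ∘ (j ∷_))) js)
        ≈⟨ solve 5 (λ a b v g p → (a :* b) :* (v :* g) :- a :* (v :* p) := a :* v :* (b :* g :- p)) refl _ _ _ _ _ ⟩
      w j * W * (x j * G js - (x ⋏ (G ∘ (j ∷_))) js) ∎
      where W = Π-list R js w

  ⋏-map : ∀ {I J : Set} (φ : I → J) (x : J → Carrier) G js →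
    (x ⋏ G) (map φ js) ≈ ((x ∘ φ) ⋏ (G ∘ map φ)) js
  ⋏-map φ x G []       = refl
  ⋏-map φ x G (j ∷ js) = +-congˡ (-‿cong (⋏-map φ x _ js))

-- Sums of minors, Pfaffians and rank-two updates

double : ℕ → ℕ
double zero    = zero
double (suc m) = suc (suc (double m))

module MinorSums {c ℓ} (R : CommutativeRing c ℓ) where
  open CommutativeRing R hiding (zero)
  open IntegerCoefficients R
  open Exterior R
  open Relation.Binary.Reasoning.Setoid setoid

  σ : ℕ → Carrier
  σ zero    = 1#
  σ (suc n) = - σ n

  -- Parity as a ring element: a change of parity becomes the polynomial 1 - p, so the solver treats
  -- both parities at once.
  par : ℕ → Carrier
  par zero    = 0#
  par (suc n) = 1# - par n

  par-pred : ∀ n → par n ≈ 1# - par (suc n)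
  par-pred n = solve 1 (λ p → p := con (+ 1) :- (con (+ 1) :- p)) refl (par n)

  σ-pred : ∀ n → σ n ≈ - σ (suc n)
  σ-pred n = solve 1 (λ p → p := :- :- p) refl (σ n)

  -- The sum of (-1)^(c₁ + ⋯ + cₖ) X_c₁ ⋏ ⋯ ⋏ X_cₖ ⋏ δ over c₁ < ⋯ < cₖ (counted from 1); the
  -- factor σ accounts for the shift of the indices when a row is put in front.
  minorSum : ∀ {J : Set} {n} → (Fin n → J → Carrier) → List J → Carrier
  minorSum {n = zero}  X js = δ js
  minorSum {n = suc n} X js =
    σ (length js) * (minorSum (X ∘ suc) js + (X zero ⋏ minorSum (X ∘ suc)) js)

  minorSum-cong : ∀ {J : Set} {n} {X Z : Fin n → J → Carrier} → (∀ i j → X i j ≈ Z i j) →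
    ∀ js → minorSum X js ≈ minorSum Z js
  minorSum-cong {n = zero}  e js = refl
  minorSum-cong {n = suc n} e js =
    *-congˡ (+-cong (minorSum-cong (e ∘ suc) js)
                    (⋏-cong js (e zero) (minorSum-cong (e ∘ suc))))

  δ-map : ∀ {I J : Set} (φ : I → J) js → δ (map φ js) ≡ δ js
  δ-map φ []      = ≡.refl
  δ-map φ (_ ∷ _) = ≡.refl

  minorSum-map : ∀ {I J : Set} {n} (φ : I → J) (X : Fin n → J → Carrier) js →
    minorSum X (map φ js) ≈ minorSum (λ i → X i ∘ φ) js
  minorSum-map {n = zero}  φ X js = reflexive (δ-map φ js)
  minorSum-map {n = suc n} φ X js =
    *-cong (reflexive (≡.cong σ (length-map φ js)))
           (+-cong (minorSum-map φ (X ∘ suc) js)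
                   (trans (⋏-map φ (X zero) _ js) (⋏-congʳ _ js (minorSum-map φ (X ∘ suc)))))

  -- Row 0 of D, without its first entry, times the rows X that follow row 0.
  alt : ∀ {J : Set} {n} → (Fin n → J → Carrier) → J → Carrier
  alt {n = zero}  X j = 0#
  alt {n = suc n} X j = - (X zero j + alt (X ∘ suc) j)

  -- A new row x replaces u by -(x + u) and F, up to sign, by F + x ⋏ F. In the product x ⋏ x ⋏ F
  -- vanishes, and u ⋏ x ⋏ F is -(1 - p) times x ⋏ F by induction one degree lower; so x ⋏ F is left
  -- with coefficient p, the same as F.
  alt-⋏-minorSum : ∀ {J : Set} {n} (X : Fin n → J → Carrier) js →
    (alt X ⋏ minorSum X) js ≈ par (length js) * minorSum X js
  alt-⋏-minorSum {n = zero}  X []       = sym (zeroˡ _)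
  alt-⋏-minorSum {n = zero}  X (j ∷ js) = trans (⋏-0ˡ δ (j ∷ js)) (sym (zeroʳ _))
  alt-⋏-minorSum {n = suc n} X js = begin
    (alt X ⋏ minorSum X) js
      -- The covector meets `minorSum` one degree lower, where `σ` has the opposite sign; this
      -- cancels the minus sign in `alt`.
      ≈⟨ ⋏-graded σ (λ k → - σ k) (alt X) H js σ-pred ⟩
    - s * (alt X ⋏ H) js
      ≈⟨ *-congˡ (⋏-cong js (λ j → solve 1 (λ a → :- a := con -1ℤ :* a) refl (x j + u j)) (λ _ → refl)) ⟩
    - s * ((λ j → - 1# * (x j + u j)) ⋏ H) js
      ≈⟨ *-congˡ (trans (⋏-*ˡ (- 1#) _ H js) (*-congˡ (⋏-+ˡ x u H js))) ⟩
    - s * (- 1# * ((x ⋏ H) js + (u ⋏ H) js))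
      ≈⟨ *-congˡ (*-congˡ (+-cong (⋏-+ʳ x F (x ⋏ F) js) (⋏-+ʳ u F (x ⋏ F) js))) ⟩
    - s * (- 1# * (((x ⋏ F) js + (x ⋏ (x ⋏ F)) js) + ((u ⋏ F) js + (u ⋏ (x ⋏ F)) js)))
      ≈⟨ *-congˡ (*-congˡ (+-cong (+-congˡ (⋏-self x F js))
                                  (+-cong (alt-⋏-minorSum (X ∘ suc) js) x⋏u⋏F))) ⟩
    - s * (- 1# * (((x ⋏ F) js + 0#) + (p * F js + - ((1# - p) * (x ⋏ F) js))))
      ≈⟨ solve 4 (λ s p f xf → :- s :* (con -1ℤ :* ((xf :+ con (+ 0)) :+ (p :* f :+ :- ((con (+ 1) :- p) :* xf))))
                               := p :* (s :* (f :+ xf))) refl s p (F js) ((x ⋏ F) js) ⟩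
    p * (s * (F js + (x ⋏ F) js)) ∎
    where
    x = X zero
    u = alt (X ∘ suc)
    F = minorSum (X ∘ suc)
    H = λ t → F t + (x ⋏ F) t
    s = σ (length js)
    p = par (length js)
    x⋏u⋏F : (u ⋏ (x ⋏ F)) js ≈ - ((1# - p) * (x ⋏ F) js)
    x⋏u⋏F = trans (⋏-anticomm u x F js)
      (-‿cong (trans (⋏-congʳ x js (alt-⋏-minorSum (X ∘ suc)))
                     (⋏-graded par (λ k → 1# - par k) x F js par-pred)))

  σ-double : ∀ m → σ (double m) ≈ 1#
  σ-double zero    = refl
  σ-double (suc m) = trans (sym (σ-pred (double m))) (σ-double m)

  par-double : ∀ m → par (double m) ≈ 0#
  par-double zero    = refl
  par-double (suc m) = trans (sym (par-pred (double m))) (par-double m)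

  par-1+double : ∀ m → par (suc (double m)) ≈ 1#
  par-1+double m = trans (+-congˡ (-‿cong (par-double m))) (solve 0 (con (+ 1) :- con (+ 0) := con (+ 1)) refl)

  -- The index m is the number of pairs: Pf m Y vanishes on lists of length ≠ 2m.
  Pf : ∀ {J : Set} → ℕ → (J → J → Carrier) → List J → Carrier
  Pf zero    Y js       = δ js
  Pf (suc m) Y []       = 0#
  Pf (suc m) Y (j ∷ js) = (Y j ⋏ Pf m Y) js

  -- One pair fewer, and zero when there is none to remove, so that `Pf-∷` and `Pf-update` have no
  -- exception at m = 0.
  Pf⁻ : ∀ {J : Set} → ℕ → (J → J → Carrier) → List J → Carrier
  Pf⁻ zero    Y js = 0#
  Pf⁻ (suc m) Y js = Pf m Y js

  Pf-∷ : ∀ {J : Set} m (Y : J → J → Carrier) j js → Pf m Y (j ∷ js) ≈ (Y j ⋏ Pf⁻ m Y) js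
  Pf-∷ zero    Y j js = sym (⋏-0ʳ (Y j) js)
  Pf-∷ (suc m) Y j js = refl

  Pf-cong : ∀ {J : Set} m {Y Z : J → J → Carrier} → (∀ i j → Y i j ≈ Z i j) →
    ∀ js → Pf m Y js ≈ Pf m Z js
  Pf-cong zero    e js       = refl
  Pf-cong (suc m) e []       = refl
  Pf-cong (suc m) e (j ∷ js) = ⋏-cong js (e j) (Pf-cong m e)

  -- The rule pf(WYW) = det(W) pf(Y) for a diagonal matrix W: every column index occurs in exactly
  -- one factor of each term.
  Pf-weight : ∀ {J : Set} m (w : J → Carrier) (Y : J → J → Carrier) js →
    Pf m (λ i j → w i * w j * Y i j) js ≈ Π-list R js w * Pf m Y js
  Pf-weight zero    w Y []       = sym (*-identityʳ _)
  Pf-weight zero    w Y (j ∷ js) = sym (zeroʳ _)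
  Pf-weight (suc m) w Y []       = sym (zeroʳ _)
  Pf-weight (suc m) w Y (j ∷ js) = begin
    ((λ i → w j * w i * Y j i) ⋏ Pf m (λ i j → w i * w j * Y i j)) js
      ≈⟨ ⋏-cong js (λ i → *-assoc _ _ _) (Pf-weight m w Y) ⟩
    ((λ i → w j * (w i * Y j i)) ⋏ (λ t → Π-list R t w * Pf m Y t)) js
      ≈⟨ ⋏-*ˡ _ _ _ js ⟩
    w j * ((λ i → w i * Y j i) ⋏ (λ t → Π-list R t w * Pf m Y t)) js
      ≈⟨ *-congˡ (⋏-weight w (Y j) (Pf m Y) js) ⟩
    w j * (Π-list R js w * (Y j ⋏ Pf m Y) js)
      ≈⟨ *-assoc _ _ _ ⟨
    w j * Π-list R js w * (Y j ⋏ Pf m Y) js ∎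

  module _ {J : Set} (x u : J → Carrier) (Y : J → J → Carrier) where

    update : J → J → Carrier
    update i j = Y i j + (x i * u j - u i * x j)

    ⋏-update : ∀ i G js →
      (update i ⋏ G) js ≈ (Y i ⋏ G) js + (x i * (u ⋏ G) js - u i * (x ⋏ G) js)
    ⋏-update i G js = begin
      (update i ⋏ G) js
        ≈⟨ ⋏-cong js (λ j → solve 5 (λ y a b c d → y :+ (a :* b :- c :* d) := y :+ (a :* b :+ :- c :* d))
                              refl _ _ _ _ _) (λ _ → refl) ⟩
      ((λ j → Y i j + (x i * u j + - u i * x j)) ⋏ G) js
        ≈⟨ trans (⋏-+ˡ (Y i) _ G js) (+-congˡ (⋏-+ˡ _ _ G js)) ⟩
      (Y i ⋏ G) js + (((λ j → x i * u j) ⋏ G) js + ((λ j → - u i * x j) ⋏ G) js)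
        ≈⟨ +-congˡ (+-cong (⋏-*ˡ (x i) u G js) (⋏-*ˡ (- u i) x G js)) ⟩
      (Y i ⋏ G) js + (x i * (u ⋏ G) js + - u i * (x ⋏ G) js)
        ≈⟨ solve 5 (λ y a b c d → y :+ (a :* b :+ :- c :* d) := y :+ (a :* b :- c :* d)) refl _ _ _ _ _ ⟩
      (Y i ⋏ G) js + (x i * (u ⋏ G) js - u i * (x ⋏ G) js) ∎

    -- The 2-form of x and u has square zero, so the Pfaffian is affine in it. In the expansion
    -- along the first column, the terms of second order contain x or u twice and vanish.
    Pf-update : ∀ m js → Pf m update js ≈ Pf m Y js + (x ⋏ (u ⋏ Pf⁻ m Y)) js
    Pf-update zero    js = begin
      δ js                                     ≈⟨ +-identityʳ _ ⟨
      δ js + 0#                                ≈⟨ +-congˡ (⋏-0ʳ x js) ⟨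
      δ js + (x ⋏ (λ _ → 0#)) js               ≈⟨ +-congˡ (⋏-congʳ x js (⋏-0ʳ u)) ⟨
      δ js + (x ⋏ (u ⋏ (λ _ → 0#))) js         ∎
    Pf-update (suc m) []       = sym (+-identityˡ 0#)
    Pf-update (suc m) (j ∷ js) = begin
      (update j ⋏ Pf m update) js
        ≈⟨ ⋏-congʳ (update j) js (Pf-update m) ⟩
      (update j ⋏ (λ t → P t + (x ⋏ (u ⋏ P⁻)) t)) js
        ≈⟨ ⋏-+ʳ (update j) P _ js ⟩
      (update j ⋏ P) js + (update j ⋏ (x ⋏ (u ⋏ P⁻))) js
        ≈⟨ +-cong (⋏-update j P js) (⋏-update j _ js) ⟩
      ((y ⋏ P) js + (x j * (u ⋏ P) js - u j * (x ⋏ P) js))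
        + ((y ⋏ (x ⋏ (u ⋏ P⁻))) js + (x j * (u ⋏ (x ⋏ (u ⋏ P⁻))) js - u j * (x ⋏ (x ⋏ (u ⋏ P⁻))) js))
        -- `y` crosses two covectors and keeps its sign; the other two terms repeat `u` or `x`.
        ≈⟨ +-congˡ (+-cong yxu (+-cong (*-congˡ uxu) (-‿cong (*-congˡ (⋏-self x _ js))))) ⟩
      ((y ⋏ P) js + (x j * (u ⋏ P) js - u j * (x ⋏ P) js))
        + ((x ⋏ (u ⋏ (y ⋏ P⁻))) js + (x j * 0# - u j * 0#))
        ≈⟨ solve 6 (λ a b c d e f → (a :+ (b :* c :- d :* e)) :+ (f :+ (b :* con (+ 0) :- d :* con (+ 0)))
                                 := a :+ (b :* c :- (d :* e :- f))) refl _ _ _ _ _ _ ⟩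
      (y ⋏ P) js + (x j * (u ⋏ P) js - (u j * (x ⋏ P) js - (x ⋏ (u ⋏ (y ⋏ P⁻))) js))
        -- `y ⋏ P⁻` is `P` with first column j, and the antiderivation rule then gathers the terms
        -- into `x ⋏ (u ⋏ P)` at `j ∷ js`.
        ≈⟨ +-congˡ (+-congˡ (-‿cong (+-congˡ (-‿cong (⋏-congʳ x js (λ t → ⋏-congʳ u t (Pf-∷ m Y j))))))) ⟨
      (y ⋏ P) js + (x j * (u ⋏ P) js - (u j * (x ⋏ P) js - (x ⋏ (u ⋏ (P ∘ (j ∷_)))) js))
        ≈⟨ +-congˡ (+-congˡ (-‿cong (⋏-∷ x u P j js))) ⟨
      (y ⋏ P) js + (x j * (u ⋏ P) js - (x ⋏ ((u ⋏ P) ∘ (j ∷_))) js) ∎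
      where
      y  = Y j
      P  = Pf m Y
      P⁻ = Pf⁻ m Y
      ⋏-neg : ∀ (z : J → Carrier) G t → (z ⋏ (λ t → - G t)) t ≈ - (z ⋏ G) t
      ⋏-neg z G t = trans (⋏-congʳ z t (λ t → solve 1 (λ a → :- a := con -1ℤ :* a) refl (G t)))
        (trans (⋏-*ʳ (- 1#) z G t) (solve 1 (λ a → con -1ℤ :* a := :- a) refl _))
      yxu : (y ⋏ (x ⋏ (u ⋏ P⁻))) js ≈ (x ⋏ (u ⋏ (y ⋏ P⁻))) js
      yxu = begin
        (y ⋏ (x ⋏ (u ⋏ P⁻))) js          ≈⟨ ⋏-anticomm y x _ js ⟩
        - (x ⋏ (y ⋏ (u ⋏ P⁻))) js        ≈⟨ -‿cong (⋏-congʳ x js (⋏-anticomm y u P⁻)) ⟩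
        - (x ⋏ (λ t → - (u ⋏ (y ⋏ P⁻)) t)) js  ≈⟨ -‿cong (⋏-neg x _ js) ⟩
        - - (x ⋏ (u ⋏ (y ⋏ P⁻))) js      ≈⟨ solve 1 (λ a → :- :- a := a) refl _ ⟩
        (x ⋏ (u ⋏ (y ⋏ P⁻))) js          ∎
      uxu : (u ⋏ (x ⋏ (u ⋏ P⁻))) js ≈ 0#
      uxu = begin
        (u ⋏ (x ⋏ (u ⋏ P⁻))) js   ≈⟨ ⋏-anticomm u x _ js ⟩
        - (x ⋏ (u ⋏ (u ⋏ P⁻))) js ≈⟨ -‿cong (⋏-congʳ x js (⋏-self u P⁻)) ⟩
        - (x ⋏ (λ _ → 0#)) js     ≈⟨ -‿cong (⋏-0ʳ x js) ⟩
        - 0#                      ≈⟨ solve 0 (:- con (+ 0) := con (+ 0)) refl ⟩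
        0#                        ∎

  gramRec : ∀ {J : Set} {n} → (Fin n → J → Carrier) → J → J → Carrier
  gramRec {n = zero}  X i j = 0#
  gramRec {n = suc n} X     = update (X zero) (alt (X ∘ suc)) (gramRec (X ∘ suc))

  Pf-0 : ∀ {J : Set} m (js : List J) → Pf (suc m) (λ _ _ → 0#) js ≈ 0#
  Pf-0 m []       = refl
  Pf-0 m (j ∷ js) = ⋏-0ˡ _ js

  Pf-gramRec : ∀ {J : Set} {n} (X : Fin n → J → Carrier) m js → length js ≡ double m →
    Pf m (gramRec X) js ≈ minorSum X js
  Pf-gramRec {n = zero}  X zero    js       e = refl
  Pf-gramRec {n = zero}  X (suc m) (j ∷ js) e = Pf-0 m (j ∷ js)
  Pf-gramRec {n = suc n} X m       js       e = begin
    Pf m (update x u Y) js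
      ≈⟨ Pf-update x u Y m js ⟩
    Pf m Y js + (x ⋏ (u ⋏ Pf⁻ m Y)) js
      ≈⟨ +-cong (Pf-gramRec (X ∘ suc) m js e) (second m js e) ⟩
    F js + (x ⋏ F) js
      ≈⟨ *-identityˡ _ ⟨
    1# * (F js + (x ⋏ F) js)
      ≈⟨ *-congʳ (trans (reflexive (≡.cong σ e)) (σ-double m)) ⟨
    σ (length js) * (F js + (x ⋏ F) js) ∎
    where
    x = X zero
    u = alt (X ∘ suc)
    Y = gramRec (X ∘ suc)
    F = minorSum (X ∘ suc)
    second : ∀ m js → length js ≡ double m → (x ⋏ (u ⋏ Pf⁻ m Y)) js ≈ (x ⋏ F) js
    second zero    []  e = refl
    -- `t` has odd length, where `u ⋏ F` equals `F`; the lists `t′` one letter shorter have even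
    -- length again, so the identity already known for the rows after `x` applies to them.
    second (suc m) js  e = ⋏-cong-length js (λ _ → refl) λ t p → begin
      (u ⋏ Pf m Y) t
        ≈⟨ ⋏-cong-length t (λ _ → refl)
             (λ t′ q → Pf-gramRec (X ∘ suc) m t′ (suc-injective (suc-injective
                         (≡.trans (≡.cong suc q) (≡.trans p e))))) ⟩
      (u ⋏ F) t              ≈⟨ alt-⋏-minorSum (X ∘ suc) t ⟩
      par (length t) * F t   ≈⟨ *-congʳ (trans (reflexive (≡.cong par (suc-injective (≡.trans p e))))
                                               (par-1+double m)) ⟩
      1# * F t               ≈⟨ *-identityˡ _ ⟩
      F t                    ∎

  -- Appending a column of ones

  ⋏-∷ʳ : ∀ {J : Set} (x : J → Carrier) G js z →
    (x ⋏ G) (js ++ [ z ]) ≈ (x ⋏ (λ t → G (t ++ [ z ]))) js + σ (length js) * (x z * G js)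
  ⋏-∷ʳ x G []       z = solve 2 (λ a g → a :* g :- con (+ 0) := con (+ 0) :+ con (+ 1) :* (a :* g)) refl _ _
  ⋏-∷ʳ x G (j ∷ js) z = trans (+-congˡ (-‿cong (⋏-∷ʳ x _ js z)))
    (solve 4 (λ a p s q → a :- (p :+ s :* q) := (a :- p) :+ :- s :* q) refl _ _ _ _)

  -- Induction on the rows evaluates the alternating sum. Up to a common sign, F enters with
  -- coefficient -p, to which the entry 1 of the new row adds 1, and x ⋏ F enters with 1 - p because
  -- it meets F one degree lower; so both coefficients are 1 - p. Here p is the parity of n + k,
  -- which is that of n - k.
  minorSum-∷ʳ-ones : ∀ {J : Set} {n} (X : Fin n → J → Carrier) z → (∀ i → X i z ≈ 1#) → ∀ js →
    minorSum X (js ++ [ z ]) ≈ - (σ (length js) * par (n ℕ.+ length js)) * minorSum X js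
  minorSum-∷ʳ-ones {n = zero}  X z e []       = solve 0 (con (+ 0) := :- (con (+ 1) :* con (+ 0)) :* con (+ 1)) refl
  minorSum-∷ʳ-ones {n = zero}  X z e (j ∷ js) = sym (zeroʳ _)
  minorSum-∷ʳ-ones {n = suc n} X z e js = begin
    σ (length (js ++ [ z ])) * (F (js ++ [ z ]) + (x ⋏ F) (js ++ [ z ]))
      ≈⟨ *-cong (reflexive (≡.cong σ (≡.trans (length-++ js) (ℕₚ.+-comm (length js) 1))))
                (+-cong (minorSum-∷ʳ-ones (X ∘ suc) z (e ∘ suc) js) (⋏-∷ʳ x F js z)) ⟩
    - s * (- (s * p) * f + ((x ⋏ (λ t → F (t ++ [ z ]))) js + s * (x z * f)))
      ≈⟨ *-congˡ (+-congˡ (+-cong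
           (trans (⋏-congʳ x js (minorSum-∷ʳ-ones (X ∘ suc) z (e ∘ suc)))
                  (⋏-graded (λ k → - (σ k * par (n ℕ.+ k))) (λ k → σ k * (1# - par (n ℕ.+ k))) x F js shift))
           (*-congˡ (*-congʳ (e zero))))) ⟩
    - s * (- (s * p) * f + ((s * (1# - p)) * xf + s * (1# * f)))
      ≈⟨ solve 4 (λ s p f xf → :- s :* (:- (s :* p) :* f :+ ((s :* (con (+ 1) :- p)) :* xf :+ s :* (con (+ 1) :* f)))
                  := :- (s :* (con (+ 1) :- p)) :* (s :* (f :+ xf))) refl s p f xf ⟩
    - (s * (1# - p)) * (s * (f + xf)) ∎
    where
    x  = X zero
    F  = minorSum (X ∘ suc)
    s  = σ (length js)
    p  = par (n ℕ.+ length js)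
    f  = F js
    xf = (x ⋏ F) js
    shift : ∀ k → - (σ k * par (n ℕ.+ k)) ≈ σ (suc k) * (1# - par (n ℕ.+ suc k))
    shift k = begin
      - (σ k * par (n ℕ.+ k))
        ≈⟨ solve 2 (λ s p → :- (s :* p) := :- s :* (con (+ 1) :- (con (+ 1) :- p))) refl _ _ ⟩
      - σ k * (1# - par (suc (n ℕ.+ k)))
        ≡⟨ ≡.cong (λ i → - σ k * (1# - par i)) (+-suc n k) ⟨
      - σ k * (1# - par (n ℕ.+ suc k)) ∎

-- Lists split at a letter, and Boolean comparisons

toList-tabulate : ∀ {A : Set} {n} (f : Fin n → A) → toList (Vec.tabulate f) ≡ tabulate f
toList-tabulate {n = zero}  f = ≡.refl
toList-tabulate {n = suc n} f = ≡.cong (f zero ∷_) (toList-tabulate (f ∘ suc))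

map-allFin : ∀ {A : Set} {n} (f : Fin n → A) → map f (allFin n) ≡ toList (Vec.tabulate f)
map-allFin f = ≡.trans (map-tabulate id f) (≡.sym (toList-tabulate f))

tuple-tabulate : ∀ {m N} (f : Fin m → Fin N) → tuple f ≡ map toℕ (toList (Vec.tabulate f))
tuple-tabulate f = ≡.trans (map-tabulate id (toℕ ∘ f))
  (≡.trans (≡.sym (map-tabulate f toℕ)) (≡.cong (map toℕ) (≡.sym (toList-tabulate f))))

module _ {A : Set} {_∼_ : A → A → Set} where

  AllPairs-ʳ++⁻ : ∀ xs {ys} → AllPairs _∼_ (xs ʳ++ ys) → All (λ x → All (x ∼_) ys) xs × AllPairs _∼_ ys
  AllPairs-ʳ++⁻ []       p = [] , p
  AllPairs-ʳ++⁻ (x ∷ xs) p with AllPairs-ʳ++⁻ xs p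
  ... | q , (r ∷ rs) = (r ∷ All.map All.tail q) , rs

  AllPairs-ʳ++⁺ : ∀ xs {ys zs} → AllPairs _∼_ (xs ʳ++ ys) → (∀ {x} → All (x ∼_) ys → All (x ∼_) zs) →
    AllPairs _∼_ zs → AllPairs _∼_ (xs ʳ++ zs)
  AllPairs-ʳ++⁺ []       p f q = q
  AllPairs-ʳ++⁺ (x ∷ xs) p f q with AllPairs-ʳ++⁻ xs p
  ... | _ , (r ∷ _) = AllPairs-ʳ++⁺ xs p (λ { (h ∷ hs) → h ∷ f hs }) (f r ∷ q)

  -- The prefix is kept reversed because `(y ∷ xs) ʳ++ ys` reduces to `xs ʳ++ (y ∷ ys)`: moving the
  -- mark along a list costs no rewriting.
  AllPairs-remove : ∀ xs {y ys} → AllPairs _∼_ (xs ʳ++ (y ∷ ys)) →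
    All (_∼ y) xs × All (y ∼_) ys × AllPairs _∼_ (xs ʳ++ ys)
  AllPairs-remove xs p with AllPairs-ʳ++⁻ xs p
  ... | q , (r ∷ rs) = All.map All.head q , r , AllPairs-ʳ++⁺ xs p All.tail rs

length-remove : ∀ {A : Set} (xs : List A) y ys → length (xs ʳ++ (y ∷ ys)) ≡ suc (length (xs ʳ++ ys))
length-remove xs y ys = ≡.trans (length-ʳ++ xs)
  (≡.trans (+-suc (length xs) (length ys)) (≡.cong suc (≡.sym (length-ʳ++ xs))))

∈-split : ∀ {A : Set} {y : A} {zs} → y ∈ zs → ∃₂ λ xs ys → zs ≡ xs ʳ++ (y ∷ ys)
∈-split = go []
  where
  go : ∀ {A : Set} {y : A} (xs : List A) {zs} → y ∈ zs → ∃₂ λ xs′ ys → xs ʳ++ zs ≡ xs′ ʳ++ (y ∷ ys)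
  go xs (here ≡.refl)   = xs , _ , ≡.refl
  go xs (there {z} y∈)  = go (z ∷ xs) y∈

<ᵇ-true : ∀ {m n} → m < n → (m <ᵇ n) ≡ true
<ᵇ-true = Equivalence.to T-≡ ∘ <⇒<ᵇ

<ᵇ-false : ∀ {m n} → ¬ m < n → (m <ᵇ n) ≡ false
<ᵇ-false {m} {n} ¬p with m <ᵇ n in eq
... | false = ≡.refl
... | true  = contradiction (<ᵇ⇒< m n (Equivalence.from T-≡ eq)) ¬p

≡ᵇ-refl : ∀ n → (n ≡ᵇ n) ≡ true
≡ᵇ-refl n = Equivalence.to T-≡ (≡⇒≡ᵇ n n ≡.refl)

≡ᵇ-false : ∀ {m n} → m ≢ n → (m ≡ᵇ n) ≡ false
≡ᵇ-false {m} {n} m≢n with m ≡ᵇ n in eq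
... | false = ≡.refl
... | true  = contradiction (≡ᵇ⇒≡ m n (Equivalence.from T-≡ eq)) m≢n

allFin-ascending : ∀ n → AllPairs _<ᶠ_ (allFin n)
allFin-ascending n = tabulate⁺-< id

-- Sums over words, and the sign as a product over pairs

module Sums {c ℓ} (R : CommutativeRing c ℓ) where
  open CommutativeRing R hiding (zero)
  open IntegerCoefficients R
  open Exterior R
  open MinorSums R
  open Relation.Binary.Reasoning.Setoid setoid

  Σ′ : ∀ {A : Set} → List A → (A → Carrier) → Carrier
  Σ′ = Σ-list R

  Π′ : ∀ {A : Set} → List A → (A → Carrier) → Carrier
  Π′ = Π-list R

  module _ {A : Set} where

    Σ-cong-∈ : ∀ (xs : List A) {f g} → (∀ {a} → a ∈ xs → f a ≈ g a) → Σ′ xs f ≈ Σ′ xs g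
    Σ-cong-∈ []       e = refl
    Σ-cong-∈ (x ∷ xs) e = +-cong (e (here ≡.refl)) (Σ-cong-∈ xs (e ∘ there))

    Σ-cong : ∀ (xs : List A) {f g} → (∀ a → f a ≈ g a) → Σ′ xs f ≈ Σ′ xs g
    Σ-cong xs e = Σ-cong-∈ xs (λ {a} _ → e a)

    Σ-0 : ∀ (xs : List A) {f} → (∀ {a} → a ∈ xs → f a ≈ 0#) → Σ′ xs f ≈ 0#
    Σ-0 []       e = refl
    Σ-0 (x ∷ xs) e = trans (+-cong (e (here ≡.refl)) (Σ-0 xs (e ∘ there))) (+-identityˡ 0#)

    Σ-+ : ∀ (xs : List A) f g → Σ′ xs (λ a → f a + g a) ≈ Σ′ xs f + Σ′ xs g
    Σ-+ []       f g = sym (+-identityˡ 0#)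
    Σ-+ (x ∷ xs) f g = trans (+-congˡ (Σ-+ xs f g))
      (solve 4 (λ a b c d → (a :+ b) :+ (c :+ d) := (a :+ c) :+ (b :+ d)) refl _ _ _ _)

    Σ-*ˡ : ∀ (xs : List A) r f → Σ′ xs (λ a → r * f a) ≈ r * Σ′ xs f
    Σ-*ˡ []       r f = sym (zeroʳ r)
    Σ-*ˡ (x ∷ xs) r f = trans (+-congˡ (Σ-*ˡ xs r f)) (sym (distribˡ r _ _))

    Σ-++ : ∀ (xs ys : List A) f → Σ′ (xs ++ ys) f ≈ Σ′ xs f + Σ′ ys f
    Σ-++ []       ys f = sym (+-identityˡ _)
    Σ-++ (x ∷ xs) ys f = trans (+-congˡ (Σ-++ xs ys f)) (sym (+-assoc _ _ _))

    Σ-ʳ++ : ∀ (xs ys : List A) f → Σ′ (xs ʳ++ ys) f ≈ Σ′ xs f + Σ′ ys f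
    Σ-ʳ++ []       ys f = sym (+-identityˡ _)
    Σ-ʳ++ (x ∷ xs) ys f = trans (Σ-ʳ++ xs (x ∷ ys) f)
      (solve 3 (λ a b c → a :+ (b :+ c) := (b :+ a) :+ c) refl _ _ _)

    Π-ʳ++ : ∀ (xs ys : List A) f → Π′ (xs ʳ++ ys) f ≈ Π′ xs f * Π′ ys f
    Π-ʳ++ []       ys f = sym (*-identityˡ _)
    Π-ʳ++ (x ∷ xs) ys f = trans (Π-ʳ++ xs (x ∷ ys) f)
      (solve 3 (λ a b c → a :* (b :* c) := (b :* a) :* c) refl _ _ _)

    Σ-remove : ∀ (xs : List A) y ys {f} → f y ≈ 0# → Σ′ (xs ʳ++ (y ∷ ys)) f ≈ Σ′ (xs ʳ++ ys) f
    Σ-remove xs y ys {f} e = begin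
      Σ′ (xs ʳ++ (y ∷ ys)) f       ≈⟨ Σ-ʳ++ xs (y ∷ ys) f ⟩
      Σ′ xs f + (f y + Σ′ ys f)    ≈⟨ +-congˡ (trans (+-congʳ e) (+-identityˡ _)) ⟩
      Σ′ xs f + Σ′ ys f            ≈⟨ Σ-ʳ++ xs ys f ⟨
      Σ′ (xs ʳ++ ys) f             ∎

    Σ-filter : ∀ (p : A → Bool) xs f → Σ′ (filterᵇ p xs) f ≈ Σ′ xs (λ a → if p a then f a else 0#)
    Σ-filter p []       f = refl
    Σ-filter p (x ∷ xs) f with p x
    ... | true  = +-congˡ (Σ-filter p xs f)
    ... | false = trans (Σ-filter p xs f) (sym (+-identityˡ _))

    Σ-⋏ : ∀ pre post (f H : A → Carrier) (G : List A → Carrier) →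
      (∀ pre′ a post′ → pre′ ʳ++ (a ∷ post′) ≡ pre ʳ++ post →
        H a ≈ σ (length pre′) * G (pre′ ʳ++ post′)) →
      Σ′ post (λ a → f a * H a) ≈ σ (length pre) * (f ⋏ (λ t → G (pre ʳ++ t))) post
    Σ-⋏ pre []         f H G e = sym (zeroʳ _)
    Σ-⋏ pre (a ∷ post) f H G e = trans
      (+-cong (*-congˡ (e pre a post ≡.refl)) (Σ-⋏ (a ∷ pre) post f H G e))
      (solve 4 (λ x s g p → x :* (s :* g) :+ :- s :* p := s :* (x :* g :- p)) refl _ _ _ _)

    -- The source of all Laplace expansions below: it suffices that the cofactor of each letter is
    -- `G` of the other letters, with the sign of the position of that letter.
    Σ-expand : ∀ js (f H : A → Carrier) (G : List A → Carrier) →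
      (∀ pre a post → pre ʳ++ (a ∷ post) ≡ js → H a ≈ σ (length pre) * G (pre ʳ++ post)) →
      Σ′ js (λ a → f a * H a) ≈ (f ⋏ G) js
    Σ-expand js f H G e = trans (Σ-⋏ [] js f H G e) (*-identityˡ _)

  Σ-map : ∀ {A B : Set} (φ : A → B) xs f → Σ′ (map φ xs) f ≈ Σ′ xs (f ∘ φ)
  Σ-map φ []       f = refl
  Σ-map φ (x ∷ xs) f = +-congˡ (Σ-map φ xs f)

  Σ-concatMap : ∀ {A B : Set} (k : A → List B) xs f → Σ′ (concatMap k xs) f ≈ Σ′ xs (λ a → Σ′ (k a) f)
  Σ-concatMap k []       f = refl
  Σ-concatMap k (x ∷ xs) f = trans (Σ-++ (k x) (concatMap k xs) f) (+-congˡ (Σ-concatMap k xs f))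

  -- Vectors are determined by their letters, whereas functions on `Fin m` agree only pointwise;
  -- `Vec.tabulate` carries the sums in the definitions over to these nested sums.
  wordSum : ∀ {J : Set} m → List J → (Vec J m → Carrier) → Carrier
  wordSum zero    js g = g []
  wordSum (suc m) js g = Σ′ js (λ a → wordSum m js (λ v → g (a ∷ v)))

  module _ {J : Set} where

    wordSum-cong : ∀ m (js : List J) {g h} → (∀ v → g v ≈ h v) → wordSum m js g ≈ wordSum m js h
    wordSum-cong zero    js e = e []
    wordSum-cong (suc m) js e = Σ-cong js (λ a → wordSum-cong m js (λ v → e (a ∷ v)))

    wordSum-0 : ∀ m (js : List J) {g} → (∀ v → g v ≈ 0#) → wordSum m js g ≈ 0#
    wordSum-0 zero    js e = e []
    wordSum-0 (suc m) js e = Σ-0 js (λ {a} _ → wordSum-0 m js (λ v → e (a ∷ v)))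

    wordSum-+ : ∀ m (js : List J) g h → wordSum m js (λ v → g v + h v) ≈ wordSum m js g + wordSum m js h
    wordSum-+ zero    js g h = refl
    wordSum-+ (suc m) js g h = trans (Σ-cong js (λ a → wordSum-+ m js _ _)) (Σ-+ js _ _)

    wordSum-*ˡ : ∀ m (js : List J) r g → wordSum m js (λ v → r * g v) ≈ r * wordSum m js g
    wordSum-*ˡ zero    js r g = refl
    wordSum-*ˡ (suc m) js r g = trans (Σ-cong js (λ a → wordSum-*ˡ m js r _)) (Σ-*ˡ js r _)

    wordSum-Σ : ∀ {A : Set} m (js : List J) (xs : List A) (g : A → Vec J m → Carrier) →
      wordSum m js (λ v → Σ′ xs (λ a → g a v)) ≈ Σ′ xs (λ a → wordSum m js (g a))
    wordSum-Σ m js []       g = wordSum-0 m js (λ _ → refl)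
    wordSum-Σ m js (x ∷ xs) g = trans (wordSum-+ m js _ _) (+-congˡ (wordSum-Σ m js xs g))

  Σ-allFuns : ∀ m {N} {h : (Fin m → Fin N) → Carrier} {g} → (∀ f → h f ≈ g (Vec.tabulate f)) →
    Σ′ (allFuns m N) h ≈ wordSum m (allFin N) g
  Σ-allFuns zero    e = trans (+-identityʳ _) (e _)
  Σ-allFuns (suc m) {N} {h} {g} e = begin
    Σ′ (allFuns (suc m) N) h
      ≈⟨ Σ-concatMap _ (allFuns m N) h ⟩
    Σ′ (allFuns m N) (λ f → Σ′ (map _ (allFin N)) h)
      ≈⟨ Σ-allFuns m (λ f → trans (Σ-map _ (allFin N) h) (Σ-cong (allFin N) (λ a → e _))) ⟩
    wordSum m (allFin N) (λ v → Σ′ (allFin N) (λ a → g (a ∷ v)))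
      -- The first letter varies in the inner loop of `allFuns` but in the outer one of `wordSum`.
      ≈⟨ wordSum-Σ m (allFin N) (allFin N) (λ a v → g (a ∷ v)) ⟩
    Σ′ (allFin N) (λ a → wordSum m (allFin N) (λ v → g (a ∷ v))) ∎

  Σ-filter-allFuns : ∀ m {N} (p : (Fin m → Fin N) → Bool) {t g} →
    (∀ f → (if p f then t f else 0#) ≈ g (Vec.tabulate f)) →
    Σ′ (filterᵇ p (allFuns m N)) t ≈ wordSum m (allFin N) g
  Σ-filter-allFuns m p e = trans (Σ-filter p (allFuns m _) _) (Σ-allFuns m e)

  sign-σ : ∀ n → sign R n ≈ σ n
  sign-σ zero          = refl
  sign-σ (suc zero)    = refl
  sign-σ (suc (suc n)) = trans (sign-σ n) (σ-pred n)

  σ-+ : ∀ m n → σ (m ℕ.+ n) ≈ σ m * σ n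
  σ-+ zero    n = sym (*-identityˡ _)
  σ-+ (suc m) n = trans (-‿cong (σ-+ m n)) (solve 2 (λ a b → :- (a :* b) := :- a :* b) refl _ _)

  -- The contribution of a letter a standing before b. The value zero on equal letters treats
  -- repetitions together with inversions and makes `sgn` multiplicative.
  sgn₂ : ℕ → ℕ → Carrier
  sgn₂ a b = if b ≡ᵇ a then 0# else if b <ᵇ a then - 1# else 1#

  sgn₂-refl : ∀ a → sgn₂ a a ≈ 0#
  sgn₂-refl a rewrite ≡ᵇ-refl a = refl

  sgn₂-> : ∀ {a b} → b < a → sgn₂ a b ≈ - 1#
  sgn₂-> b<a rewrite ≡ᵇ-false (<⇒≢ b<a) | <ᵇ-true b<a = refl

  sgn₂-< : ∀ {a b} → a < b → sgn₂ a b ≈ 1#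
  sgn₂-< a<b rewrite ≡ᵇ-false (<⇒≢ a<b ∘ ≡.sym) | <ᵇ-false (<⇒≯ a<b) = refl

  Π-sgn₂ : ∀ a w → Π′ w (sgn₂ a) ≈
    (if foldr (λ y b → (y ≡ᵇ a) ∨ b) false w then 0# else σ (length (filterᵇ (λ y → y <ᵇ a) w)))
  Π-sgn₂ a []      = refl
  Π-sgn₂ a (y ∷ w) with y ≡ᵇ a
  ... | true  = zeroˡ _
  ... | false with foldr (λ y b → (y ≡ᵇ a) ∨ b) false w | Π-sgn₂ a w
  ...   | true  | ih = trans (*-congˡ ih) (zeroʳ _)
  ...   | false | ih with y <ᵇ a
  ...     | true  = trans (*-congˡ ih) (solve 1 (λ s → con -1ℤ :* s := :- s) refl _)
  ...     | false = trans (*-congˡ ih) (*-identityˡ _)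

  sgn-∷ : ∀ a w → sgn R (a ∷ w) ≈ Π′ w (sgn₂ a) * sgn R w
  sgn-∷ a w with foldr (λ y b → (y ≡ᵇ a) ∨ b) false w | Π-sgn₂ a w
  ... | true  | e = sym (trans (*-congʳ e) (zeroˡ _))
  ... | false | e with hasRepeat w
  ...   | true  = sym (zeroʳ _)
  ...   | false = begin
    sign R (n ℕ.+ inversions w)   ≈⟨ sign-σ (n ℕ.+ inversions w) ⟩
    σ (n ℕ.+ inversions w)        ≈⟨ σ-+ n (inversions w) ⟩
    σ n * σ (inversions w)        ≈⟨ *-cong e (sign-σ (inversions w)) ⟨
    Π′ w (sgn₂ a) * sign R (inversions w) ∎
    where n = length (filterᵇ (λ y → y <ᵇ a) w)

  -- Words with a repeated letter contribute zero, so a sum over permutations becomes one over all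
  -- words, which can be nested letter by letter.
  sgn-repeat : ∀ w {r} → (if not (hasRepeat w) then sgn R w * r else 0#) ≈ sgn R w * r
  sgn-repeat w with hasRepeat w
  ... | true  = sym (zeroˡ _)
  ... | false = refl

  -- Leibniz expansion

  module _ {K : ℕ} where

    ε : Fin K → Fin K → Carrier
    ε a b = sgn₂ (toℕ a) (toℕ b)

    Π-toℕ : ∀ a (w : List (Fin K)) → Π′ (map toℕ w) (sgn₂ (toℕ a)) ≈ Π′ w (ε a)
    Π-toℕ a []      = refl
    Π-toℕ a (b ∷ w) = *-congˡ (Π-toℕ a w)

    -- In an ascending list the letters smaller than a are those before it, so its comparisons yield
    -- the Laplace sign of its position.
    Π-ε : ∀ {a} pre {post} → All (_<ᶠ a) pre → All (a <ᶠ_) post → Π′ (pre ʳ++ post) (ε a) ≈ σ (length pre)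
    Π-ε {a} pre {post} p q = trans (Π-ʳ++ pre post (ε a))
      (trans (*-cong (left pre p) (right post q)) (*-identityʳ _))
      where
      left : ∀ pre → All (_<ᶠ a) pre → Π′ pre (ε a) ≈ σ (length pre)
      left []        []       = refl
      left (b ∷ pre) (p ∷ ps) = trans (*-cong (sgn₂-> p) (left pre ps))
        (solve 1 (λ s → con -1ℤ :* s := :- s) refl _)
      right : ∀ post → All (a <ᶠ_) post → Π′ post (ε a) ≈ 1#
      right []         []       = refl
      right (b ∷ post) (p ∷ ps) = trans (*-cong (sgn₂-< p) (right post ps)) (*-identityˡ _)

    rowProduct : ∀ {m} → Vec (Fin K → Carrier) m → Vec (Fin K) m → Carrier
    rowProduct []       []      = 1#
    rowProduct (r ∷ rs) (a ∷ v) = r a * rowProduct rs v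

    weighted : ∀ {m} → (Fin K → Carrier) → Vec (Fin K → Carrier) m → Vec (Fin K → Carrier) m
    weighted w = Vec.map (λ r b → w b * r b)

    rowProduct-weighted : ∀ {m} w (rs : Vec _ m) v →
      rowProduct (weighted w rs) v ≈ Π′ (toList v) w * rowProduct rs v
    rowProduct-weighted w []       []      = sym (*-identityˡ _)
    rowProduct-weighted w (r ∷ rs) (a ∷ v) = trans (*-congˡ (rowProduct-weighted w rs v))
      (solve 4 (λ w r p q → w :* r :* (p :* q) := w :* p :* (r :* q)) refl _ _ _ _)

    -- Each later letter b contributes sgn₂ a b to the sign of a word starting with a, so that
    -- factor is absorbed into the remaining rows.
    leibniz : ∀ {m} → Vec (Fin K → Carrier) m → List (Fin K) → Carrier
    leibniz []       js = 1#
    leibniz (r ∷ rs) js = Σ′ js (λ a → r a * leibniz (weighted (ε a) rs) js)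

    leibniz-wordSum : ∀ {m} (rs : Vec _ m) js →
      leibniz rs js ≈ wordSum m js (λ v → sgn R (map toℕ (toList v)) * rowProduct rs v)
    leibniz-wordSum []       js = sym (*-identityˡ 1#)
    leibniz-wordSum {suc m} (r ∷ rs) js = Σ-cong js λ a → begin
      r a * leibniz (weighted (ε a) rs) js
        ≈⟨ *-congˡ (leibniz-wordSum (weighted (ε a) rs) js) ⟩
      r a * wordSum m js (λ v → sgn R (map toℕ (toList v)) * rowProduct (weighted (ε a) rs) v)
        ≈⟨ wordSum-*ˡ m js (r a) _ ⟨
      wordSum m js (λ v → r a * (sgn R (map toℕ (toList v)) * rowProduct (weighted (ε a) rs) v))
        ≈⟨ wordSum-cong m js (λ v → step a v) ⟩
      wordSum m js (λ v → sgn R (toℕ a ∷ map toℕ (toList v)) * (r a * rowProduct rs v)) ∎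
      where
      step : ∀ a v → r a * (sgn R (map toℕ (toList v)) * rowProduct (weighted (ε a) rs) v)
                     ≈ sgn R (toℕ a ∷ map toℕ (toList v)) * (r a * rowProduct rs v)
      step a v = begin
        r a * (s * rowProduct (weighted (ε a) rs) v)
          ≈⟨ *-congˡ (*-congˡ (rowProduct-weighted (ε a) rs v)) ⟩
        r a * (s * (Π′ (toList v) (ε a) * rowProduct rs v))
          ≈⟨ solve 4 (λ r s p q → r :* (s :* (p :* q)) := (p :* s) :* (r :* q)) refl _ _ _ _ ⟩
        (Π′ (toList v) (ε a) * s) * (r a * rowProduct rs v)
          ≈⟨ *-congʳ (*-congʳ (Π-toℕ a (toList v))) ⟨
        (Π′ (map toℕ (toList v)) (sgn₂ (toℕ a)) * s) * (r a * rowProduct rs v)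
          ≈⟨ *-congʳ (sgn-∷ (toℕ a) (map toℕ (toList v))) ⟨
        sgn R (toℕ a ∷ map toℕ (toList v)) * (r a * rowProduct rs v) ∎
        where s = sgn R (map toℕ (toList v))

    leibniz-remove : ∀ {m} (rs : Vec _ m) pre b post → VecAll.All (λ r → r b ≈ 0#) rs →
      leibniz rs (pre ʳ++ (b ∷ post)) ≈ leibniz rs (pre ʳ++ post)
    leibniz-remove []       pre b post VecAll.[]       = refl
    leibniz-remove (r ∷ rs) pre b post (z VecAll.∷ zs) = trans
      (Σ-remove pre b post (trans (*-congʳ z) (zeroˡ _)))
      (Σ-cong (pre ʳ++ post) (λ a → *-congˡ (leibniz-remove (weighted (ε a) rs) pre b post (vanish (ε a) rs zs))))
      where
      vanish : ∀ {m} w (rs : Vec _ m) → VecAll.All (λ r → r b ≈ 0#) rs → VecAll.All (λ r → r b ≈ 0#) (weighted w rs)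
      vanish w []       VecAll.[]       = VecAll.[]
      vanish w (r ∷ rs) (z VecAll.∷ zs) = trans (*-congˡ z) (zeroʳ _) VecAll.∷ vanish w rs zs

    rowsForm : ∀ {m} → Vec (Fin K → Carrier) m → List (Fin K) → Carrier
    rowsForm []       = δ
    rowsForm (r ∷ rs) = r ⋏ rowsForm rs

    rowsForm-weighted : ∀ {m} w (rs : Vec _ m) js → rowsForm (weighted w rs) js ≈ Π′ js w * rowsForm rs js
    rowsForm-weighted w []       []       = sym (*-identityˡ _)
    rowsForm-weighted w []       (j ∷ js) = sym (zeroʳ _)
    rowsForm-weighted w (r ∷ rs) js       =
      trans (⋏-congʳ _ js (rowsForm-weighted w rs)) (⋏-weight w r (rowsForm rs) js)

    -- Once a is chosen for the first row, the other rows carry the factor `ε a`, which is zero at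
    -- a; so a can be struck from the list, and the factors at the other letters come out as the
    -- sign of its position. In the base case the length condition leaves only the empty list, where
    -- `δ` is 1.
    leibniz-rowsForm : ∀ {m} (rs : Vec _ m) js → AllPairs _<ᶠ_ js → length js ≡ m → leibniz rs js ≈ rowsForm rs js
    leibniz-rowsForm []       []  _   _  = refl
    leibniz-rowsForm (r ∷ rs) js  asc e  = Σ-expand js r (λ a → leibniz (weighted (ε a) rs) js) (rowsForm rs) term
      where
      term : ∀ pre a post → pre ʳ++ (a ∷ post) ≡ js →
        leibniz (weighted (ε a) rs) js ≈ σ (length pre) * rowsForm rs (pre ʳ++ post)
      term pre a post ≡.refl with AllPairs-remove pre asc
      ... | p , q , asc′ = begin
        leibniz (weighted (ε a) rs) (pre ʳ++ (a ∷ post))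
          ≈⟨ leibniz-remove (weighted (ε a) rs) pre a post (vanish rs) ⟩
        leibniz (weighted (ε a) rs) (pre ʳ++ post)
          ≈⟨ leibniz-rowsForm (weighted (ε a) rs) (pre ʳ++ post) asc′
               (suc-injective (≡.trans (≡.sym (length-remove pre a post)) e)) ⟩
        rowsForm (weighted (ε a) rs) (pre ʳ++ post)
          ≈⟨ rowsForm-weighted (ε a) rs (pre ʳ++ post) ⟩
        Π′ (pre ʳ++ post) (ε a) * rowsForm rs (pre ʳ++ post)
          ≈⟨ *-congʳ (Π-ε pre p q) ⟩
        σ (length pre) * rowsForm rs (pre ʳ++ post) ∎
        where
        vanish : ∀ {m} (rs : Vec _ m) → VecAll.All (λ r → r a ≈ 0#) (weighted (ε a) rs)
        vanish []       = VecAll.[]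
        vanish (r ∷ rs) = trans (*-congʳ (sgn₂-refl (toℕ a))) (zeroˡ _) VecAll.∷ vanish rs

  Π-tabulate : ∀ {K m k} (A : Fin k → Fin K → Carrier) (τ : Fin k → Fin K) (ι : Fin m → Fin k) →
    Π′ (tabulate ι) (λ i → A i (τ i)) ≈ rowProduct (Vec.tabulate (A ∘ ι)) (Vec.tabulate (τ ∘ ι))
  Π-tabulate {m = zero}  A τ ι = refl
  Π-tabulate {m = suc m} A τ ι = *-congˡ (Π-tabulate A τ (ι ∘ suc))

  det-rowsForm : ∀ {k} (A : Fin k → Fin k → Carrier) → det R A ≈ rowsForm (Vec.tabulate A) (allFin k)
  det-rowsForm {k} A = begin
    det R A
      ≈⟨ Σ-filter-allFuns k isPerm (λ τ → trans (sgn-repeat (tuple τ))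
           (*-cong (reflexive (≡.cong (sgn R) (tuple-tabulate τ))) (Π-tabulate A τ id))) ⟩
    wordSum k (allFin k) (λ v → sgn R (map toℕ (toList v)) * rowProduct (Vec.tabulate A) v)
      ≈⟨ leibniz-wordSum (Vec.tabulate A) (allFin k) ⟨
    leibniz (Vec.tabulate A) (allFin k)
      ≈⟨ leibniz-rowsForm (Vec.tabulate A) (allFin k) (allFin-ascending k) (length-tabulate id) ⟩
    rowsForm (Vec.tabulate A) (allFin k) ∎

-- Cullis' sum over increasing words of rows

increasing-0∈ : ∀ x {w} → 0 ∈ w → increasing (x ∷ w) ≡ false
increasing-0∈ x {y ∷ _} (here ≡.refl) = ≡.refl
increasing-0∈ x {y ∷ w} (there 0∈w)   =
  ≡.trans (≡.cong ((x <ᵇ y) ∧_) (increasing-0∈ y 0∈w)) (∧-zeroʳ (x <ᵇ y))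

increasing-suc : ∀ w → increasing (map suc w) ≡ increasing w
increasing-suc []          = ≡.refl
increasing-suc (x ∷ [])    = ≡.refl
increasing-suc (x ∷ y ∷ w) = ≡.cong ((x <ᵇ y) ∧_) (increasing-suc (y ∷ w))

increasing-0∷ : ∀ w → increasing (0 ∷ map suc w) ≡ increasing w
increasing-0∷ []      = ≡.refl
increasing-0∷ (x ∷ w) = increasing-suc (x ∷ w)

toℕ-suc : ∀ {n m} (v : Vec (Fin n) m) → map toℕ (toList (Vec.map suc v)) ≡ map suc (map toℕ (toList v))
toℕ-suc []      = ≡.refl
toℕ-suc (a ∷ v) = ≡.cong (_ ∷_) (toℕ-suc v)

toℕ-zero∈ : ∀ {n} {w : List (Fin (suc n))} → zero ∈ w → 0 ∈ map toℕ w
toℕ-zero∈ (here ≡.refl) = here ≡.refl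
toℕ-zero∈ (there p)     = there (toℕ-zero∈ p)

length-word : ∀ {n m} (v : Vec (Fin n) m) → length (map toℕ (toList v)) ≡ m
length-word []      = ≡.refl
length-word (a ∷ v) = ≡.cong suc (length-word v)

module CullisSum {c ℓ} (R : CommutativeRing c ℓ) where
  open CommutativeRing R hiding (zero)
  open IntegerCoefficients R
  open Exterior R
  open MinorSums R
  open Sums R
  open Relation.Binary.Reasoning.Setoid setoid

  module _ {J : Set} where

    ⋏-Σ : ∀ {A : Set} (x : J → Carrier) (xs : List A) (g : A → List J → Carrier) js →
      (x ⋏ (λ t → Σ′ xs (λ a → g a t))) js ≈ Σ′ xs (λ a → (x ⋏ g a) js)
    ⋏-Σ x []       g js = ⋏-0ʳ x js
    ⋏-Σ x (a ∷ xs) g js = trans (⋏-+ʳ x _ _ js) (+-congˡ (⋏-Σ x xs g js))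

    ⋏-wordSum : ∀ {I : Set} (x : J → Carrier) m (is : List I) (g : Vec I m → List J → Carrier) js →
      (x ⋏ (λ t → wordSum m is (λ v → g v t))) js ≈ wordSum m is (λ v → (x ⋏ g v) js)
    ⋏-wordSum x zero    is g js = refl
    ⋏-wordSum x (suc m) is g js = trans (⋏-Σ x is _ js) (Σ-cong is (λ a → ⋏-wordSum x m is _ js))

  wordSum-remove : ∀ {J : Set} m z (js : List J) {g : Vec J m → Carrier} →
    (∀ v → z ∈ toList v → g v ≈ 0#) → wordSum m (z ∷ js) g ≈ wordSum m js g
  wordSum-remove zero    z js e = refl
  wordSum-remove (suc m) z js {g} e = begin
    wordSum m (z ∷ js) (λ v → g (z ∷ v)) + Σ′ js (λ a → wordSum m (z ∷ js) (λ v → g (a ∷ v)))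
      ≈⟨ +-cong (wordSum-0 m (z ∷ js) (λ v → e (z ∷ v) (here ≡.refl)))
                (Σ-cong js (λ a → wordSum-remove m z js (λ v p → e (a ∷ v) (there p)))) ⟩
    0# + wordSum (suc m) js g
      ≈⟨ +-identityˡ _ ⟩
    wordSum (suc m) js g ∎

  wordSum-map : ∀ {I J : Set} (φ : I → J) m is (g : Vec J m → Carrier) →
    wordSum m (map φ is) g ≈ wordSum m is (g ∘ Vec.map φ)
  wordSum-map φ zero    is g = refl
  wordSum-map φ (suc m) is g =
    trans (Σ-map φ is _) (Σ-cong is (λ a → wordSum-map φ m is _))

  -- The coefficient of a choice of rows in Cullis' sum, extended by zero to all words; letters
  -- count from 0, the exponent from 1.
  χ : List ℕ → Carrier
  χ w = if increasing w then σ (foldr ℕ._+_ 0 (map suc w)) else 0#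

  σ-sum-suc : ∀ w → σ (foldr ℕ._+_ 0 (map suc (map suc w))) ≈ σ (length w) * σ (foldr ℕ._+_ 0 (map suc w))
  σ-sum-suc []      = sym (*-identityˡ _)
  σ-sum-suc (x ∷ w) = begin
    - - σ (x ℕ.+ foldr ℕ._+_ 0 (map suc (map suc w)))   ≈⟨ -‿cong (-‿cong (trans (σ-+ x _) (*-congˡ (σ-sum-suc w)))) ⟩
    - - (σ x * (σ (length w) * s))                      ≈⟨ solve 3 (λ a b c → :- :- (a :* (b :* c)) := :- b :* :- (a :* c)) refl _ _ _ ⟩
    - σ (length w) * - (σ x * s)                        ≈⟨ *-congˡ (-‿cong (σ-+ x _)) ⟨
    - σ (length w) * - σ (x ℕ.+ foldr ℕ._+_ 0 (map suc w)) ∎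
    where s = σ (foldr ℕ._+_ 0 (map suc w))

  χ-suc : ∀ w → χ (map suc w) ≈ σ (length w) * χ w
  χ-suc w rewrite increasing-suc w with increasing w
  ... | true  = σ-sum-suc w
  ... | false = sym (zeroʳ _)

  χ-0∷ : ∀ w → χ (0 ∷ map suc w) ≈ - σ (length w) * χ w
  χ-0∷ w rewrite increasing-0∷ w with increasing w
  ... | true  = trans (-‿cong (σ-sum-suc w)) (solve 2 (λ a b → :- (a :* b) := :- a :* b) refl _ _)
  ... | false = sym (zeroʳ _)

  χ-0∈ : ∀ x {w} → 0 ∈ w → χ (x ∷ w) ≈ 0#
  χ-0∈ x 0∈w rewrite increasing-0∈ x 0∈w = refl

  module _ {K : ℕ} where

    rowSum : ∀ {n} m → (Fin n → Fin K → Carrier) → List (Fin K) → Carrier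
    rowSum {n} m X js = wordSum m (allFin n) (λ v → χ (map toℕ (toList v)) * rowsForm (Vec.map X v) js)

    wordSum-suc : ∀ {n} m (g : Vec (Fin (suc n)) m → Carrier) →
      wordSum m (tabulate suc) g ≈ wordSum m (allFin n) (g ∘ Vec.map suc)
    wordSum-suc {n} m g = trans
      (reflexive (≡.cong (λ is → wordSum m is g) (≡.sym (map-tabulate id suc))))
      (wordSum-map suc m (allFin n) g)

    -- An increasing word starts with row 0 or avoids it. Shifting the remaining indices by one
    -- gives `σ` of their number; if row 0 is chosen, its own index 1 supplies the missing sign, so
    -- both cases carry `σ (suc m)`.
    rowSum-suc : ∀ {n} m (X : Fin (suc n) → Fin K → Carrier) js →
      rowSum (suc m) X js ≈ σ (suc m) * (rowSum (suc m) (X ∘ suc) js + (X zero ⋏ rowSum m (X ∘ suc)) js)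
    rowSum-suc {n} m X js = begin
      wordSum m (zero ∷ L) (λ v → g (zero ∷ v)) + Σ′ L (λ a → wordSum m (zero ∷ L) (λ v → g (a ∷ v)))
        ≈⟨ +-cong (wordSum-remove m zero L (λ v p → vanish zero v p))
                  (Σ-cong L (λ a → wordSum-remove m zero L (λ v p → vanish a v p))) ⟩
      wordSum m L (λ v → g (zero ∷ v)) + wordSum (suc m) L g
        ≈⟨ +-cong (wordSum-suc m _) (wordSum-suc (suc m) g) ⟩
      wordSum m (allFin n) (λ v → g (zero ∷ Vec.map suc v)) + wordSum (suc m) (allFin n) (g ∘ Vec.map suc)
        ≈⟨ +-cong (wordSum-cong m (allFin n) with0) (wordSum-cong (suc m) (allFin n) without0) ⟩
      wordSum m (allFin n) (λ v → σ (suc m) * (X zero ⋏ g′ v) js)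
        + wordSum (suc m) (allFin n) (λ v → σ (suc m) * g′ v js)
        ≈⟨ +-cong (wordSum-*ˡ m (allFin n) _ _) (wordSum-*ˡ (suc m) (allFin n) _ (λ v → g′ v js)) ⟩
      σ (suc m) * wordSum m (allFin n) (λ v → (X zero ⋏ g′ v) js) + σ (suc m) * rowSum (suc m) (X ∘ suc) js
        ≈⟨ +-congʳ (*-congˡ (⋏-wordSum (X zero) m (allFin n) g′ js)) ⟨
      σ (suc m) * (X zero ⋏ rowSum m (X ∘ suc)) js + σ (suc m) * rowSum (suc m) (X ∘ suc) js
        ≈⟨ solve 3 (λ s a b → s :* a :+ s :* b := s :* (b :+ a)) refl _ _ _ ⟩
      σ (suc m) * (rowSum (suc m) (X ∘ suc) js + (X zero ⋏ rowSum m (X ∘ suc)) js) ∎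
      where
      L = tabulate suc
      g : ∀ {m} → Vec (Fin (suc n)) m → Carrier
      g v = χ (map toℕ (toList v)) * rowsForm (Vec.map X v) js
      g′ : ∀ {m} → Vec (Fin n) m → List (Fin K) → Carrier
      g′ v t = χ (map toℕ (toList v)) * rowsForm (Vec.map (X ∘ suc) v) t
      vanish : ∀ {m} a (v : Vec (Fin (suc n)) m) → zero ∈ toList v → g (a ∷ v) ≈ 0#
      vanish a v p = trans (*-congʳ (χ-0∈ (toℕ a) (toℕ-zero∈ p))) (zeroˡ _)
      without0 : ∀ {m} (v : Vec (Fin n) m) → g (Vec.map suc v) ≈ σ m * g′ v js
      without0 {m} v = begin
        χ (map toℕ (toList (Vec.map suc v))) * rowsForm (Vec.map X (Vec.map suc v)) js
          ≡⟨ ≡.cong₂ (λ w rs → χ w * rowsForm rs js) (toℕ-suc v) (≡.sym (map-∘ X suc v)) ⟩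
        χ (map suc w) * rowsForm (Vec.map (X ∘ suc) v) js
          ≈⟨ *-congʳ (χ-suc w) ⟩
        σ (length w) * χ w * rowsForm (Vec.map (X ∘ suc) v) js
          ≈⟨ *-assoc _ _ _ ⟩
        σ (length w) * g′ v js
          ≡⟨ ≡.cong (λ l → σ l * g′ v js) (length-word v) ⟩
        σ m * g′ v js ∎
        where w = map toℕ (toList v)
      with0 : ∀ {m} (v : Vec (Fin n) m) → g (zero ∷ Vec.map suc v) ≈ σ (suc m) * (X zero ⋏ g′ v) js
      with0 {m} v = begin
        χ (0 ∷ map toℕ (toList (Vec.map suc v))) * (X zero ⋏ rowsForm (Vec.map X (Vec.map suc v))) js
          ≡⟨ ≡.cong₂ (λ w rs → χ (0 ∷ w) * (X zero ⋏ rowsForm rs) js) (toℕ-suc v) (≡.sym (map-∘ X suc v)) ⟩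
        χ (0 ∷ map suc w) * (X zero ⋏ rowsForm rs) js
          ≈⟨ *-congʳ (χ-0∷ w) ⟩
        - σ (length w) * χ w * (X zero ⋏ rowsForm rs) js
          ≈⟨ *-assoc _ _ _ ⟩
        - σ (length w) * (χ w * (X zero ⋏ rowsForm rs) js)
          ≈⟨ *-cong (reflexive (≡.cong (-_ ∘ σ) (length-word v))) (sym (⋏-*ʳ (χ w) (X zero) (rowsForm rs) js)) ⟩
        σ (suc m) * (X zero ⋏ g′ v) js ∎
        where
        w  = map toℕ (toList v)
        rs = Vec.map (X ∘ suc) v

    rowSum-minorSum : ∀ {n} m (X : Fin n → Fin K → Carrier) js → length js ≡ m → rowSum m X js ≈ minorSum X js
    rowSum-minorSum {zero}  zero    X js       e = *-identityˡ _
    rowSum-minorSum {zero}  (suc m) X (_ ∷ js) e = refl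
    rowSum-minorSum {suc n} zero    X []       e = begin
      1# * 1#                             ≈⟨ *-congˡ (*-identityˡ 1#) ⟨
      1# * rowSum {n} 0 (X ∘ suc) []      ≈⟨ *-congˡ (rowSum-minorSum 0 (X ∘ suc) [] ≡.refl) ⟩
      1# * minorSum (X ∘ suc) []          ≈⟨ *-congˡ (+-identityʳ _) ⟨
      1# * (minorSum (X ∘ suc) [] + 0#)   ∎
    rowSum-minorSum {suc n} (suc m) X js e = trans (rowSum-suc m X js)
      (*-cong (reflexive (≡.cong σ (≡.sym e)))
        (+-cong (rowSum-minorSum (suc m) (X ∘ suc) js e)
                (⋏-cong-length js (λ _ → refl)
                  (λ t p → rowSum-minorSum m (X ∘ suc) t (suc-injective (≡.trans p e))))))

  cullisFormula-minorSum : ∀ n k (X : Fin n → Fin k → Carrier) →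
    cullisFormula R n k X ≈ sign R (tri k) * minorSum X (allFin k)
  cullisFormula-minorSum n k X = *-congˡ (trans
    (Σ-filter-allFuns k (λ c → increasing (tuple c)) term)
    (rowSum-minorSum k X (allFin k) (length-tabulate id)))
    where
    χ-if : ∀ w {d e} → d ≈ e →
      (if increasing w then sign R (foldr ℕ._+_ 0 (map suc w)) * d else 0#) ≈ χ w * e
    χ-if w p with increasing w
    ... | true  = *-cong (sign-σ (foldr ℕ._+_ 0 (map suc w))) p
    ... | false = sym (zeroˡ _)
    term : ∀ (f : Fin k → Fin n) →
      (if increasing (tuple f) then sign R (foldr ℕ._+_ 0 (map suc (tuple f))) * det R (λ a b → X (f a) b) else 0#)
      ≈ χ (map toℕ (toList (Vec.tabulate f))) * rowsForm (Vec.map X (Vec.tabulate f)) (allFin k)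
    term f = trans (χ-if (tuple f) (det-rowsForm (X ∘ f)))
      (reflexive (≡.cong₂ (λ w rs → χ w * rowsForm rs (allFin k)) (tuple-tabulate f) (tabulate-∘ X f)))

  -- Gram matrices

  open import Algebra.Properties.Semiring.Sum semiring using (sum; sum-cong-≋; ∑-distrib-+; *-distribˡ-sum)

  foldr-sum : ∀ {n} (f : Fin n → Carrier) → foldr _+_ 0# (map f (allFin n)) ≡ sum f
  foldr-sum f = ≡.trans (≡.cong (foldr _+_ 0#) (map-tabulate id f)) (go f)
    where
    go : ∀ {n} (f : Fin n → Carrier) → foldr _+_ 0# (tabulate f) ≡ sum f
    go {zero}  f = ≡.refl
    go {suc n} f = ≡.cong (λ s → f zero + s) (go (f ∘ suc))

  σ-sign-suc-suc : ∀ a b → sign R (suc a ℕ.+ suc b) ≈ σ (a ℕ.+ b)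
  σ-sign-suc-suc a b = trans (sign-σ (suc a ℕ.+ suc b))
    (trans (reflexive (≡.cong (-_ ∘ σ) (+-suc a b))) (sym (σ-pred (a ℕ.+ b))))

  D-0-0 : ∀ n → D R (suc n) zero zero ≈ 0#
  D-0-0 n = zeroʳ _

  D-0-suc : ∀ {n} (b : Fin n) → D R (suc n) zero (suc b) ≈ - σ (toℕ b)
  D-0-suc b = trans (*-identityʳ _) (σ-sign-suc-suc 0 (suc (toℕ b)))

  D-suc-0 : ∀ {n} (b : Fin n) → D R (suc n) (suc b) zero ≈ σ (toℕ b)
  D-suc-0 b = trans (*-congʳ (trans (σ-sign-suc-suc (suc (toℕ b)) 0)
      (reflexive (≡.cong (-_ ∘ σ) (ℕₚ.+-identityʳ (toℕ b))))))
    (solve 1 (λ s → :- s :* con -1ℤ := s) refl _)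

  D-suc-suc : ∀ {n} (a b : Fin n) → D R (suc n) (suc a) (suc b) ≈ D R n a b
  D-suc-suc a b = *-cong (begin
    sign R (suc (suc (toℕ a)) ℕ.+ suc (suc (toℕ b)))  ≈⟨ σ-sign-suc-suc (suc (toℕ a)) (suc (toℕ b)) ⟩
    - σ (toℕ a ℕ.+ suc (toℕ b))                       ≈⟨ reflexive (≡.cong (-_ ∘ σ) (+-suc (toℕ a) (toℕ b))) ⟩
    - - σ (toℕ a ℕ.+ toℕ b)                           ≈⟨ σ-pred (toℕ a ℕ.+ toℕ b) ⟨
    σ (toℕ a ℕ.+ toℕ b)                               ≈⟨ σ-sign-suc-suc (toℕ a) (toℕ b) ⟨
    sign R (suc (toℕ a) ℕ.+ suc (toℕ b)) ∎)
    -- The two `sgn` filter different lists and do not reduce to a common form; their factors `sgn₂`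
    -- do, since comparisons of successors compute.
    (trans (sgn-∷ (suc (suc (toℕ a))) (suc (suc (toℕ b)) ∷ [])) (sym (sgn-∷ (suc (toℕ a)) (suc (toℕ b) ∷ []))))

  alt-sum : ∀ {J : Set} {n} (X : Fin n → J → Carrier) j → alt X j ≈ sum (λ l → - σ (toℕ l) * X l j)
  alt-sum {n = zero}  X j = refl
  alt-sum {n = suc n} X j = begin
    - (X zero j + alt (X ∘ suc) j)
      ≈⟨ solve 2 (λ a b → :- (a :+ b) := con -1ℤ :* a :+ con -1ℤ :* b) refl _ _ ⟩
    - 1# * X zero j + - 1# * alt (X ∘ suc) j
      ≈⟨ +-congˡ (trans (*-congˡ (alt-sum (X ∘ suc) j)) (*-distribˡ-sum (- 1#) (λ l → - σ (toℕ l) * X (suc l) j))) ⟩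
    - 1# * X zero j + sum (λ l → - 1# * (- σ (toℕ l) * X (suc l) j))
      ≈⟨ +-congˡ (sum-cong-≋ (λ l → solve 2 (λ s a → con -1ℤ :* (:- s :* a) := :- :- s :* a) refl (σ (toℕ l)) (X (suc l) j))) ⟩
    - 1# * X zero j + sum (λ l → - - σ (toℕ l) * X (suc l) j) ∎

  gram-sum : ∀ {n k} (X : Fin n → Fin k → Carrier) i j →
    gram R X i j ≈ sum (λ l → sum (λ l′ → X l′ i * D R n l′ l) * X l j)
  gram-sum {n} X i j = trans (reflexive (foldr-sum {n} _))
    (sum-cong-≋ {n} (λ l → *-congʳ (reflexive (foldr-sum (λ l′ → X l′ i * D R n l′ l)))))

  -- `D` has a zero corner, an alternating first row, the negative of it as first column, and a
  -- smaller `D` in the remaining block; the first row and column yield the two rank-one terms of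
  -- `update`.
  gram-gramRec : ∀ {n k} (X : Fin n → Fin k → Carrier) i j → gram R X i j ≈ gramRec X i j
  gram-gramRec {zero}  X i j = refl
  gram-gramRec {suc n} X i j = begin
    gram R X i j
      ≈⟨ gram-sum X i j ⟩
    (x i * D R (suc n) zero zero + sum (λ l′ → X (suc l′) i * D R (suc n) (suc l′) zero)) * x j
      + sum (λ l → (x i * D R (suc n) zero (suc l) + sum (λ l′ → X (suc l′) i * D R (suc n) (suc l′) (suc l))) * X (suc l) j)
      ≈⟨ +-cong (*-congʳ (+-cong (*-congˡ (D-0-0 n)) column))
                (sum-cong-≋ {n} (λ l → *-congʳ (+-cong (*-congˡ (D-0-suc l))
                  (sum-cong-≋ {n} (λ l′ → *-congˡ (D-suc-suc l′ l)))))) ⟩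
    (x i * 0# + - 1# * u i) * x j + sum (λ l → (x i * - σ (toℕ l) + S l) * X (suc l) j)
      ≈⟨ +-congˡ (sum-cong-≋ (λ l → solve 4 (λ a b c d → (a :* b :+ c) :* d := a :* (b :* d) :+ c :* d)
                                      refl (x i) (- σ (toℕ l)) (S l) (X (suc l) j))) ⟩
    (x i * 0# + - 1# * u i) * x j + sum (λ l → x i * (- σ (toℕ l) * X (suc l) j) + S l * X (suc l) j)
      ≈⟨ +-congˡ (∑-distrib-+ (λ l → x i * (- σ (toℕ l) * X (suc l) j)) (λ l → S l * X (suc l) j)) ⟩
    (x i * 0# + - 1# * u i) * x j + (sum (λ l → x i * (- σ (toℕ l) * X (suc l) j)) + sum (λ l → S l * X (suc l) j))
      ≈⟨ +-congˡ (+-cong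
           (trans (sym (*-distribˡ-sum (x i) (λ l → - σ (toℕ l) * X (suc l) j))) (*-congˡ (sym (alt-sum (X ∘ suc) j))))
           (trans (sym (gram-sum (X ∘ suc) i j)) (gram-gramRec (X ∘ suc) i j))) ⟩
    (x i * 0# + - 1# * u i) * x j + (x i * u j + gramRec (X ∘ suc) i j)
      ≈⟨ solve 5 (λ xi ui xj uj g → (xi :* con (+ 0) :+ con -1ℤ :* ui) :* xj :+ (xi :* uj :+ g)
                                     := g :+ (xi :* uj :- ui :* xj)) refl _ _ _ _ _ ⟩
    gramRec (X ∘ suc) i j + (x i * u j - u i * x j) ∎
    where
    x = X zero
    u = alt (X ∘ suc)
    S : Fin n → Carrier
    S l = sum (λ l′ → X (suc l′) i * D R n l′ l)
    column : sum (λ l′ → X (suc l′) i * D R (suc n) (suc l′) zero) ≈ - 1# * u i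
    column = begin
      sum (λ l′ → X (suc l′) i * D R (suc n) (suc l′) zero)
        ≈⟨ sum-cong-≋ (λ l → trans (*-congˡ (D-suc-0 l))
             (solve 2 (λ a s → a :* s := con -1ℤ :* (:- s :* a)) refl (X (suc l) i) (σ (toℕ l)))) ⟩
      sum (λ l′ → - 1# * (- σ (toℕ l′) * X (suc l′) i))
        ≈⟨ *-distribˡ-sum (- 1#) (λ l′ → - σ (toℕ l′) * X (suc l′) i) ⟨
      - 1# * sum (λ l′ → - σ (toℕ l′) * X (suc l′) i)
        ≈⟨ *-congˡ (alt-sum (X ∘ suc) i) ⟨
      - 1# * u i ∎

-- The Pfaffian as a sum over words of pairs

firsts : List ℕ → List ℕ
firsts w = map proj₁ (pairs w)

pairsIncrease : List ℕ → Bool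
pairsIncrease w = foldr (λ p b → (proj₁ p <ᵇ proj₂ p) ∧ b) true (pairs w)

-- The conditions of `inΠ` other than being a permutation, on words of numbers so that pairs can be
-- split off.
matching : List ℕ → Bool
matching w = increasing (firsts w) ∧ pairsIncrease w

∧-true : ∀ {a b} → a ∧ b ≡ true → a ≡ true × b ≡ true
∧-true {true} {true} _ = ≡.refl , ≡.refl

increasing-tail : ∀ a w → increasing (a ∷ w) ≡ true → increasing w ≡ true
increasing-tail a []      _ = ≡.refl
increasing-tail a (b ∷ w) e = proj₂ (∧-true {a <ᵇ b} e)

<ᵇ-true⁻ : ∀ m n → (m <ᵇ n) ≡ true → m < n
<ᵇ-true⁻ m n e = <ᵇ⇒< m n (Equivalence.from T-≡ e)

isEven-double : ∀ n → isEven n ≡ true → ∃ λ m → n ≡ double m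
isEven-double zero          e = zero , ≡.refl
isEven-double (suc (suc n)) e with isEven-double n e
... | m , ≡.refl = suc m , ≡.refl

isEven-suc : ∀ n → isEven (suc n) ≡ not (isEven n)
isEven-suc zero          = ≡.refl
isEven-suc (suc zero)    = ≡.refl
isEven-suc (suc (suc n)) = isEven-suc n

isEven-+ : ∀ m n → isEven m ≡ true → isEven (m ℕ.+ n) ≡ isEven n
isEven-+ zero          n e = ≡.refl
isEven-+ (suc (suc m)) n e = isEven-+ m n e

unsnoc-inject₁ : ∀ {k} (j : Fin k) → unsnoc (inject₁ j) ≡ just j
unsnoc-inject₁ zero    = ≡.refl
unsnoc-inject₁ (suc j) = ≡.cong (Maybe.map suc) (unsnoc-inject₁ j)

unsnoc-fromℕ : ∀ k → unsnoc (fromℕ k) ≡ nothing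
unsnoc-fromℕ zero    = ≡.refl
unsnoc-fromℕ (suc k) = ≡.cong (Maybe.map suc) (unsnoc-fromℕ k)

allFin-∷ʳ : ∀ k → allFin (suc k) ≡ map inject₁ (allFin k) ++ [ fromℕ k ]
allFin-∷ʳ k = ≡.trans (go k id) (≡.cong (_++ [ fromℕ k ]) (≡.sym (map-tabulate id inject₁)))
  where
  go : ∀ {A : Set} k (f : Fin (suc k) → A) → tabulate f ≡ tabulate (f ∘ inject₁) ++ [ f (fromℕ k) ]
  go zero    f = ≡.refl
  go (suc k) f = ≡.cong (f zero ∷_) (go k (f ∘ suc))

-- Firsts of later pairs exceed a because the firsts increase, and each second exceeds its own
-- first.
matching-above : ∀ a m w → length w ≡ double m → increasing (a ∷ firsts w) ≡ true →
  pairsIncrease w ≡ true → All (a <_) w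
matching-above a zero    []          _ _  _  = []
matching-above a (suc m) (b ∷ d ∷ w) l e₁ e₂ with ∧-true {a <ᵇ b} e₁ | ∧-true {b <ᵇ d} e₂
... | a<b , inc | b<d , asc = a<b′ ∷ <-trans a<b′ (<ᵇ-true⁻ b d b<d) ∷
  All.map (<-trans a<b′) (matching-above b m w (suc-injective (suc-injective l)) inc asc)
  where a<b′ = <ᵇ-true⁻ a b a<b

module MatchingSum {c ℓ} (R : CommutativeRing c ℓ) where
  open CommutativeRing R hiding (zero)
  open IntegerCoefficients R
  open Exterior R
  open MinorSums R
  open Sums R
  open CullisSum R
  open Relation.Binary.Reasoning.Setoid setoid

  𝟙 : Bool → Carrier
  𝟙 b = if b then 1# else 0#

  Π-1 : ∀ {A : Set} {P : A → Set} {w : List A} {f} → (∀ {c} → P c → f c ≈ 1#) → All P w → Π′ w f ≈ 1#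
  Π-1 e []       = refl
  Π-1 e (p ∷ ps) = trans (*-cong (e p) (Π-1 e ps)) (*-identityˡ 1#)

  𝟙-< : ∀ {a b} → a < b → 𝟙 (a <ᵇ b) ≈ 1#
  𝟙-< a<b rewrite <ᵇ-true a<b = refl

  𝟙-≮ : ∀ {a b} → ¬ a < b → 𝟙 (a <ᵇ b) ≈ 0#
  𝟙-≮ a≮b rewrite <ᵇ-false a≮b = refl

  𝟙-true : ∀ {b} → b ≡ true → 𝟙 b ≈ 1#
  𝟙-true ≡.refl = refl

  𝟙-false : ∀ {b} → b ≡ false → 𝟙 b ≈ 0#
  𝟙-false ≡.refl = refl

  -- In a matching a lies below all later letters, so its sign factors are 1 and can be exchanged
  -- for indicators. Comparing a with every later letter, and not just with the next first, makes
  -- the condition a product over letters.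
  matching-∷∷ : ∀ a b m w → length w ≡ double m →
    𝟙 (matching (a ∷ b ∷ w)) * (sgn₂ a b * Π′ w (sgn₂ a))
      ≈ 𝟙 (a <ᵇ b) * Π′ w (λ d → 𝟙 (a <ᵇ d)) * 𝟙 (matching w)
  matching-∷∷ a b m w l with matching (a ∷ b ∷ w) in eq
  ... | true  with ∧-true {increasing (a ∷ firsts w)} eq
  ...   | inc , rest with ∧-true {a <ᵇ b} rest
  ...     | a<b , asc = begin
    1# * (sgn₂ a b * Π′ w (sgn₂ a))
      ≈⟨ *-congˡ (*-cong (sgn₂-< (<ᵇ-true⁻ a b a<b)) (Π-1 sgn₂-< above)) ⟩
    1# * (1# * 1#)
      ≈⟨ *-assoc _ _ _ ⟨
    1# * 1# * 1#
      ≈⟨ *-cong (*-cong (𝟙-true a<b) (Π-1 𝟙-< above))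
                (𝟙-true (≡.cong₂ _∧_ (increasing-tail a (firsts w) inc) asc)) ⟨
    𝟙 (a <ᵇ b) * Π′ w (λ d → 𝟙 (a <ᵇ d)) * 𝟙 (matching w) ∎
    where above = matching-above a m w l inc asc
  matching-∷∷ a b m w l | false = trans (zeroˡ _) (sym (vanish m w l eq))
    where
    vanish : ∀ m w → length w ≡ double m → matching (a ∷ b ∷ w) ≡ false →
      𝟙 (a <ᵇ b) * Π′ w (λ d → 𝟙 (a <ᵇ d)) * 𝟙 (matching w) ≈ 0#
    vanish zero    []          l eq with a <ᵇ b
    ... | false = solve 2 (λ p q → con (+ 0) :* p :* q := con (+ 0)) refl _ _
    -- If a < b, a < d and the rest is a matching, then so is the whole word; hence one of the three
    -- fails and gives a zero factor.
    vanish (suc m) (d ∷ e ∷ w) l eq with a <ᵇ b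
    ... | false = solve 2 (λ p q → con (+ 0) :* p :* q := con (+ 0)) refl _ _
    ... | true  with a <ᵇ d
    ...   | false = solve 2 (λ p q → con (+ 1) :* (con (+ 0) :* p) :* q := con (+ 0)) refl _ _
    ...   | true  = trans (*-congˡ (𝟙-false eq)) (zeroʳ _)

  module _ {K : ℕ} where

    Matrix : Set c
    Matrix = Fin K → Fin K → Carrier

    scale : (Fin K → Carrier) → Matrix → Matrix
    scale w Y i j = w i * w j * Y i j

    pairProduct : Matrix → List (Fin K) → Carrier
    pairProduct Y v = Π′ (pairs v) (λ p → Y (proj₁ p) (proj₂ p))

    -- Each letter lies in exactly one pair, so weights on letters can be moved into the matrix.
    pairProduct-scale : ∀ w Y m v → length v ≡ double m →
      pairProduct (scale w Y) v ≈ Π′ v w * pairProduct Y v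
    pairProduct-scale w Y zero    []          l = sym (*-identityˡ _)
    pairProduct-scale w Y (suc m) (a ∷ b ∷ v) l =
      trans (*-congˡ (pairProduct-scale w Y m v (suc-injective (suc-injective l))))
        (solve 5 (λ a b y p q → a :* b :* y :* (p :* q) := a :* (b :* p) :* (y :* q)) refl _ _ _ _ _)

    Π-* : ∀ {A : Set} (v : List A) f g → Π′ v (λ a → f a * g a) ≈ Π′ v f * Π′ v g
    Π-* []      f g = sym (*-identityˡ _)
    Π-* (a ∷ v) f g = trans (*-congˡ (Π-* v f g))
      (solve 4 (λ a b c d → (a :* b) :* (c :* d) := (a :* c) :* (b :* d)) refl _ _ _ _)

    Π-map : ∀ (v : List (Fin K)) f → Π′ (map toℕ v) f ≈ Π′ v (f ∘ toℕ)
    Π-map []      f = refl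
    Π-map (a ∷ v) f = *-congˡ (Π-map v f)

    weight : Matrix → List (Fin K) → Carrier
    weight Y v = 𝟙 (matching (map toℕ v)) * (sgn R (map toℕ v) * pairProduct Y v)

    lt : Fin K → Fin K → Carrier
    lt a b = 𝟙 (toℕ a <ᵇ toℕ b)

    -- After a pair (a , b), all letters of a word in Π exceed a, so the sign contributed by a
    -- may be replaced by the indicator of that condition.
    ω : Fin K → Fin K → Fin K → Carrier
    ω a b d = lt a d * ε b d

    weight-∷∷ : ∀ Y m a b v → length v ≡ double m →
      weight Y (a ∷ b ∷ v) ≈ lt a b * Y a b * weight (scale (ω a b) Y) v
    weight-∷∷ Y m a b v l = begin
      M * (sgn R (toℕ a ∷ toℕ b ∷ w) * (Y a b * P))
        ≈⟨ *-congˡ (*-congʳ (trans (sgn-∷ (toℕ a) (toℕ b ∷ w)) (*-congˡ (sgn-∷ (toℕ b) w)))) ⟩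
      M * ((sgn₂ (toℕ a) (toℕ b) * Π′ w (sgn₂ (toℕ a))) * (Π′ w (sgn₂ (toℕ b)) * sgn R w) * (Y a b * P))
        ≈⟨ solve 6 (λ m s t u y p → m :* (s :* (t :* u) :* (y :* p)) := (m :* s) :* (t :* u :* (y :* p))) refl _ _ _ _ _ _ ⟩
      (M * (sgn₂ (toℕ a) (toℕ b) * Π′ w (sgn₂ (toℕ a)))) * (Π′ w (sgn₂ (toℕ b)) * sgn R w * (Y a b * P))
        ≈⟨ *-congʳ (matching-∷∷ (toℕ a) (toℕ b) m w (≡.trans (length-map toℕ v) l)) ⟩
      (lt a b * Π′ w (λ d → 𝟙 (toℕ a <ᵇ d)) * 𝟙 (matching w)) * (Π′ w (sgn₂ (toℕ b)) * sgn R w * (Y a b * P))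
        ≈⟨ *-cong (*-congʳ (*-congˡ (Π-map v _))) (*-congʳ (*-congʳ (Π-map v _))) ⟩
      (lt a b * Π′ v (lt a) * 𝟙 (matching w)) * (Π′ v (ε b) * sgn R w * (Y a b * P))
        ≈⟨ solve 7 (λ l p m e s y q → (l :* p :* m) :* (e :* s :* (y :* q)) := l :* y :* (m :* (s :* ((p :* e) :* q))))
             refl _ _ _ _ _ _ _ ⟩
      lt a b * Y a b * (𝟙 (matching w) * (sgn R w * ((Π′ v (lt a) * Π′ v (ε b)) * P)))
        ≈⟨ *-congˡ (*-congˡ (*-congˡ (trans (pairProduct-scale (ω a b) Y m v l) (*-congʳ (Π-* v (lt a) (ε b)))))) ⟨
      lt a b * Y a b * weight (scale (ω a b) Y) v ∎
      where
      w = map toℕ v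
      M = 𝟙 (matching (toℕ a ∷ toℕ b ∷ w))
      P = pairProduct Y v

    -- The counterpart of `leibniz` for pairs: the sign and order factors of a chosen pair are
    -- absorbed by rescaling rows and columns of the matrix.
    matchingSum : ℕ → Matrix → List (Fin K) → Carrier
    matchingSum zero    Y js = 1#
    matchingSum (suc m) Y js =
      Σ′ js (λ a → Σ′ js (λ b → lt a b * Y a b * matchingSum m (scale (ω a b) Y) js))

    matchingSum-wordSum : ∀ m Y js → matchingSum m Y js ≈ wordSum (double m) js (weight Y ∘ toList)
    matchingSum-wordSum zero    Y js = solve 0 (con (+ 1) := con (+ 1) :* (con (+ 1) :* con (+ 1))) refl
    matchingSum-wordSum (suc m) Y js = Σ-cong js λ a → Σ-cong js λ b → begin
      lt a b * Y a b * matchingSum m (scale (ω a b) Y) js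
        ≈⟨ *-congˡ (matchingSum-wordSum m (scale (ω a b) Y) js) ⟩
      lt a b * Y a b * wordSum (double m) js (weight (scale (ω a b) Y) ∘ toList)
        ≈⟨ wordSum-*ˡ (double m) js _ _ ⟨
      wordSum (double m) js (λ v → lt a b * Y a b * weight (scale (ω a b) Y) (toList v))
        ≈⟨ wordSum-cong (double m) js (λ v → weight-∷∷ Y m a b (toList v) (length-toList v)) ⟨
      wordSum (double m) js (λ v → weight Y (a ∷ b ∷ toList v)) ∎

    matchingSum-cong-∈ : ∀ m {Y Z} js → (∀ {a b} → a ∈ js → b ∈ js → Y a b ≈ Z a b) →
      matchingSum m Y js ≈ matchingSum m Z js
    matchingSum-cong-∈ zero    js e = refl
    matchingSum-cong-∈ (suc m) js e = Σ-cong-∈ js λ a∈ → Σ-cong-∈ js λ b∈ →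
      *-cong (*-congˡ (e a∈ b∈)) (matchingSum-cong-∈ m js (λ c∈ d∈ → *-congˡ (e c∈ d∈)))

    VanishesAt : Fin K → Matrix → Set ℓ
    VanishesAt b Y = ∀ a → Y b a ≈ 0# × Y a b ≈ 0#

    scale-vanishes : ∀ {b w} Y → w b ≈ 0# → VanishesAt b (scale w Y)
    scale-vanishes {b} {w} Y z a =
        trans (*-congʳ (*-congʳ z)) (solve 2 (λ p q → con (+ 0) :* p :* q := con (+ 0)) refl _ _)
      , trans (*-congʳ (*-congˡ z)) (solve 2 (λ p q → p :* con (+ 0) :* q := con (+ 0)) refl _ _)

    matchingSum-remove : ∀ m {Y} pre b post → VanishesAt b Y →
      matchingSum m Y (pre ʳ++ (b ∷ post)) ≈ matchingSum m Y (pre ʳ++ post)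
    matchingSum-remove zero    pre b post z = refl
    matchingSum-remove (suc m) {Y} pre b post z = trans
      (Σ-remove pre b post (Σ-0 (pre ʳ++ (b ∷ post)) (λ {a} _ → zero-term (proj₁ (z a)))))
      (Σ-cong (pre ʳ++ post) (λ a → trans
        (Σ-remove pre b post (zero-term (proj₂ (z a))))
        (Σ-cong (pre ʳ++ post) (λ d → *-congˡ (matchingSum-remove m pre b post
          (λ e → trans (*-congˡ (proj₁ (z e))) (zeroʳ _) , trans (*-congˡ (proj₂ (z e))) (zeroʳ _)))))))
      where
      zero-term : ∀ {p y q} → y ≈ 0# → p * y * q ≈ 0#
      zero-term y≈0 = trans (*-congʳ (*-congˡ y≈0)) (solve 2 (λ p q → p :* con (+ 0) :* q := con (+ 0)) refl _ _)

    -- The smallest letter j can only open the first pair: as a second letter or in a later pair it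
    -- meets a vanishing `lt`. When it does open it, all order factors on `js` are 1 and `ω j b`
    -- becomes `ε b`.
    matchingSum-∷ : ∀ m Y {j js} → All (j <ᶠ_) js → matchingSum (suc m) Y (j ∷ js) ≈
      matchingSum (suc m) Y js + Σ′ js (λ b → Y j b * matchingSum m (scale (ε b) Y) js)
    matchingSum-∷ m Y {j} {js} above = begin
      (t j j (j ∷ js) + Σ′ js (λ b → t j b (j ∷ js))) + Σ′ js (λ a → t a j (j ∷ js) + Σ′ js (λ b → t a b (j ∷ js)))
        ≈⟨ +-cong (+-cong (t-0 j j (<-irrefl ≡.refl)) (Σ-cong-∈ js (λ b∈ → from-j b∈)))
                  (Σ-cong-∈ js (λ {a} a∈ → +-cong (t-0 a j (j≯ a∈)) (Σ-cong js (λ b → *-congˡ (drop (j≯ a∈)))))) ⟩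
      (0# + Σ′ js (λ b → Y j b * matchingSum m (scale (ε b) Y) js)) + Σ′ js (λ a → 0# + Σ′ js (λ b → t a b js))
        ≈⟨ +-cong (+-identityˡ _) (Σ-cong js (λ a → +-identityˡ _)) ⟩
      Σ′ js (λ b → Y j b * matchingSum m (scale (ε b) Y) js) + matchingSum (suc m) Y js
        ≈⟨ +-comm _ _ ⟩
      matchingSum (suc m) Y js + Σ′ js (λ b → Y j b * matchingSum m (scale (ε b) Y) js) ∎
      where
      t : Fin K → Fin K → List (Fin K) → Carrier
      t a b js = lt a b * Y a b * matchingSum m (scale (ω a b) Y) js
      t-0 : ∀ a b {js} → ¬ a <ᶠ b → t a b js ≈ 0#
      t-0 a b a≮b = trans (*-congʳ (*-congʳ (𝟙-≮ a≮b)))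
        (solve 2 (λ p q → con (+ 0) :* p :* q := con (+ 0)) refl _ _)
      j≯ : ∀ {a} → a ∈ js → ¬ a <ᶠ j
      j≯ a∈ = <⇒≯ (All.lookup above a∈)
      drop : ∀ {a b} → ¬ a <ᶠ j →
        matchingSum m (scale (ω a b) Y) (j ∷ js) ≈ matchingSum m (scale (ω a b) Y) js
      drop a≮j = matchingSum-remove m [] j js
        (scale-vanishes Y (trans (*-congʳ (𝟙-≮ a≮j)) (zeroˡ _)))
      from-j : ∀ {b} → b ∈ js → t j b (j ∷ js) ≈ Y j b * matchingSum m (scale (ε b) Y) js
      from-j {b} b∈ = *-cong
        (trans (*-congʳ (𝟙-< (All.lookup above b∈))) (*-identityˡ _))
        (trans (drop (<-irrefl ≡.refl))
          (matchingSum-cong-∈ m js (λ c∈ d∈ → *-congʳ (*-cong (ω≈ε c∈) (ω≈ε d∈)))))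
        where
        ω≈ε : ∀ {d} → d ∈ js → ω j b d ≈ ε b d
        ω≈ε d∈ = trans (*-congʳ (𝟙-< (All.lookup above d∈))) (*-identityˡ _)

    matchingSum-scale-ε : ∀ m Y pre b post →
      matchingSum m (scale (ε b) Y) (pre ʳ++ (b ∷ post)) ≈ matchingSum m (scale (ε b) Y) (pre ʳ++ post)
    matchingSum-scale-ε m Y pre b post =
      matchingSum-remove m pre b post (scale-vanishes Y (sgn₂-refl (toℕ b)))

    -- Both letters of a chosen pair have weight zero afterwards, so m pairs need 2m letters. This
    -- discards the words that skip the smallest letter in `matchingSum-Pf`.
    matchingSum-short : ∀ m Y js → AllPairs _<ᶠ_ js → length js < double m → matchingSum m Y js ≈ 0#
    matchingSum-short (suc m) Y []       asc           l = refl
    matchingSum-short (suc m) Y (j ∷ js) (above ∷ asc) (s≤s l) = begin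
      matchingSum (suc m) Y (j ∷ js)
        ≈⟨ matchingSum-∷ m Y above ⟩
      matchingSum (suc m) Y js + Σ′ js (λ b → Y j b * matchingSum m (scale (ε b) Y) js)
        ≈⟨ +-cong (matchingSum-short (suc m) Y js asc (ℕₚ.m<n⇒m<1+n l)) (Σ-0 js (λ b∈ → trans (*-congˡ (term b∈)) (zeroʳ _))) ⟩
      0# + 0#
        ≈⟨ +-identityˡ 0# ⟩
      0# ∎
      where
      term : ∀ {b} → b ∈ js → matchingSum m (scale (ε b) Y) js ≈ 0#
      term {b} b∈ with ∈-split b∈
      ... | pre , post , ≡.refl = trans (matchingSum-scale-ε m Y pre b post)
        (matchingSum-short m _ (pre ʳ++ post) (proj₂ (proj₂ (AllPairs-remove pre asc)))
          (ℕₚ.≤-pred (≡.subst (ℕ._< suc (double m)) (length-remove pre b post) l)))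

    -- With exactly 2m letters none can be skipped, so the smallest opens the first pair. Summing
    -- over its partner b is the recursion of `Pf`: the weights `ε b` of the other letters multiply
    -- to the sign of the position of b.
    matchingSum-Pf : ∀ m Y js → AllPairs _<ᶠ_ js → length js ≡ double m → matchingSum m Y js ≈ Pf m Y js
    matchingSum-Pf zero    Y []       asc           l = refl
    matchingSum-Pf (suc m) Y (j ∷ js) (above ∷ asc) l = begin
      matchingSum (suc m) Y (j ∷ js)
        ≈⟨ matchingSum-∷ m Y above ⟩
      matchingSum (suc m) Y js + Σ′ js (λ b → Y j b * matchingSum m (scale (ε b) Y) js)
        ≈⟨ +-cong (matchingSum-short (suc m) Y js asc (ℕₚ.≤-reflexive l)) (Σ-expand js (Y j) _ (Pf m Y) term) ⟩
      0# + (Y j ⋏ Pf m Y) js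
        ≈⟨ +-identityˡ _ ⟩
      (Y j ⋏ Pf m Y) js ∎
      where
      term : ∀ pre b post → pre ʳ++ (b ∷ post) ≡ js →
        matchingSum m (scale (ε b) Y) js ≈ σ (length pre) * Pf m Y (pre ʳ++ post)
      term pre b post ≡.refl with AllPairs-remove pre asc
      ... | p , q , asc′ = begin
        matchingSum m (scale (ε b) Y) (pre ʳ++ (b ∷ post))
          ≈⟨ matchingSum-scale-ε m Y pre b post ⟩
        matchingSum m (scale (ε b) Y) (pre ʳ++ post)
          ≈⟨ matchingSum-Pf m _ (pre ʳ++ post) asc′
               (suc-injective (≡.trans (≡.sym (length-remove pre b post)) (suc-injective l))) ⟩
        Pf m (scale (ε b) Y) (pre ʳ++ post)
          ≈⟨ Pf-weight m (ε b) Y (pre ʳ++ post) ⟩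
        Π′ (pre ʳ++ post) (ε b) * Pf m Y (pre ʳ++ post)
          ≈⟨ *-congʳ (Π-ε pre p q) ⟩
        σ (length pre) * Pf m Y (pre ʳ++ post) ∎

  pf-Pf : ∀ m (Y : Fin (double m) → Fin (double m) → Carrier) → pf R Y ≈ Pf m Y (allFin (double m))
  pf-Pf m Y = begin
    pf R Y
      ≈⟨ Σ-filter-allFuns (double m) inΠ term ⟩
    wordSum (double m) (allFin (double m)) (weight Y ∘ toList)
      ≈⟨ matchingSum-wordSum m Y (allFin (double m)) ⟨
    matchingSum m Y (allFin (double m))
      ≈⟨ matchingSum-Pf m Y _ (allFin-ascending (double m)) (length-tabulate id) ⟩
    Pf m Y (allFin (double m)) ∎
    where
    unfold : ∀ w {r} → (if not (hasRepeat w) ∧ matching w then sgn R w * r else 0#)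
                       ≈ 𝟙 (matching w) * (sgn R w * r)
    unfold w with hasRepeat w | matching w
    ... | true  | b     = solve 2 (λ b r → con (+ 0) := b :* (con (+ 0) :* r)) refl (𝟙 b) _
    ... | false | true  = sym (*-identityˡ _)
    ... | false | false = sym (zeroˡ _)
    term : ∀ f → (if inΠ f then sgn R (tuple f) * pairProduct Y (map f (allFin (double m))) else 0#)
                 ≈ weight Y (toList (Vec.tabulate f))
    term f = trans (unfold (tuple f))
      (reflexive (≡.cong₂ (λ w v → 𝟙 (matching w) * (sgn R w * pairProduct Y v)) (tuple-tabulate f) (map-allFin f)))

  σ-even : ∀ n → isEven n ≡ true → σ n ≈ 1#
  σ-even n e with isEven-double n e
  ... | m , ≡.refl = σ-double m

  par-odd : ∀ n → isEven n ≡ false → par n ≈ 1#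
  par-odd n e with isEven-double (suc n) (≡.trans (isEven-suc n) (≡.cong not e))
  ... | suc m , ≡.refl = par-1+double m

  minorSum-pf : ∀ {n} k (X : Fin n → Fin k → Carrier) → isEven k ≡ true →
    minorSum X (allFin k) ≈ pf R (gram R X)
  minorSum-pf k X e with isEven-double k e
  ... | m , ≡.refl = begin
    minorSum X (allFin k)         ≈⟨ Pf-gramRec X m (allFin k) (length-tabulate id) ⟨
    Pf m (gramRec X) (allFin k)   ≈⟨ Pf-cong m (gram-gramRec X) (allFin k) ⟨
    Pf m (gram R X) (allFin k)    ≈⟨ pf-Pf m (gram R X) ⟨
    pf R (gram R X)               ∎

  -- Bordered matrices

  X′-just : ∀ {n k} (X : Fin n → Fin k → Carrier) i {j j′} → unsnoc j ≡ just j′ → X′ R X i j ≡ X i j′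
  X′-just X i {j} e with unsnoc j | e
  ... | _ | ≡.refl = ≡.refl

  X′-nothing : ∀ {n k} (X : Fin n → Fin k → Carrier) i {j} → unsnoc j ≡ nothing → X′ R X i j ≡ 1#
  X′-nothing X i {j} e with unsnoc j | e
  ... | _ | ≡.refl = ≡.refl

  -- The column of ones appended by `X′` completes the zero row to the last row (0, ..., 0, 1) of
  -- `X″`.
  zeroRow : ∀ {n} {J : Set} → (Fin n → J → Carrier) → Fin (suc n) → J → Carrier
  zeroRow X i j = maybe′ (λ i′ → X i′ j) 0# (unsnoc i)

  X″-zeroRow : ∀ {n k} (X : Fin n → Fin k → Carrier) i j → X′ R (zeroRow X) i j ≡ X″ R X i j
  X″-zeroRow X i j with unsnoc i in ei | unsnoc j in ej
  ... | just i′ | just j′ = ≡.trans (≡.cong (maybe′ (λ i′ → X i′ j′) 0#) ei) (≡.sym (X′-just X i′ ej))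
  ... | just i′ | nothing = ≡.sym (X′-nothing X i′ ej)
  ... | nothing | just j′ = ≡.cong (maybe′ (λ i′ → X i′ j′) 0#) ei
  ... | nothing | nothing = ≡.refl

  minorSum-zeroRow : ∀ {n} {J : Set} (X : Fin n → J → Carrier) js → minorSum (zeroRow X) js ≈ minorSum X js
  -- The zero row comes last and meets only `δ`, which lives in degree 0, where `σ` is 1.
  minorSum-zeroRow {zero}  X js = trans (*-congˡ (trans (+-congˡ (⋏-0ˡ δ js)) (+-identityʳ _))) (σ-δ js)
    where
    σ-δ : ∀ js → σ (length js) * δ js ≈ δ js
    σ-δ []      = *-identityˡ _
    σ-δ (_ ∷ _) = zeroʳ _
  minorSum-zeroRow {suc n} X js = *-congˡ (+-cong (tail js) (⋏-congʳ (X zero) js tail))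
    where
    zeroRow-suc : ∀ i j → zeroRow X (suc i) j ≡ zeroRow (X ∘ suc) i j
    zeroRow-suc i j with unsnoc i
    ... | just _  = ≡.refl
    ... | nothing = ≡.refl
    tail : ∀ t → minorSum (zeroRow X ∘ suc) t ≈ minorSum (X ∘ suc) t
    tail t = trans (minorSum-cong (λ i j → reflexive (zeroRow-suc i j)) t) (minorSum-zeroRow (X ∘ suc) t)

  minorSum-X′ : ∀ {n k} (X : Fin n → Fin k → Carrier) → isEven k ≡ false → isEven n ≡ true →
    minorSum (X′ R X) (allFin (suc k)) ≈ minorSum X (allFin k)
  minorSum-X′ {n} {k} X ek en = begin
    minorSum (X′ R X) (allFin (suc k))
      ≡⟨ ≡.cong (minorSum (X′ R X)) (allFin-∷ʳ k) ⟩
    minorSum (X′ R X) (map inject₁ (allFin k) ++ [ fromℕ k ])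
      ≈⟨ minorSum-∷ʳ-ones (X′ R X) (fromℕ k) (λ i → reflexive (X′-nothing X i (unsnoc-fromℕ k))) (map inject₁ (allFin k)) ⟩
    - (σ l * par (n ℕ.+ l)) * minorSum (X′ R X) (map inject₁ (allFin k))
      ≈⟨ *-cong coefficient (trans (minorSum-map inject₁ (X′ R X) (allFin k))
                                   (minorSum-cong (λ i j → reflexive (X′-just X i (unsnoc-inject₁ j))) (allFin k))) ⟩
    1# * minorSum X (allFin k)
      ≈⟨ *-identityˡ _ ⟩
    minorSum X (allFin k) ∎
    where
    l = length (map inject₁ (allFin k))
    l≡k : l ≡ k
    l≡k = ≡.trans (length-map inject₁ (allFin k)) (length-tabulate id)
    -- n + k is odd, so `par` is 1, and the remaining sign is that of the even number k + 1.
    coefficient : - (σ l * par (n ℕ.+ l)) ≈ 1#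
    coefficient = begin
      - (σ l * par (n ℕ.+ l))   ≡⟨ ≡.cong (λ i → - (σ i * par (n ℕ.+ i))) l≡k ⟩
      - (σ k * par (n ℕ.+ k))   ≈⟨ -‿cong (*-congˡ (par-odd (n ℕ.+ k) (≡.trans (isEven-+ n k en) ek))) ⟩
      - (σ k * 1#)              ≈⟨ -‿cong (*-identityʳ _) ⟩
      σ (suc k)                 ≈⟨ σ-even (suc k) (≡.trans (isEven-suc k) (≡.cong not ek)) ⟩
      1#                        ∎

  -- The three parity cases

  sign-tri-suc : ∀ k → isEven k ≡ false → sign R (tri k) ≈ sign R (tri (suc k))
  sign-tri-suc k e = sym (begin
    sign R (suc k ℕ.+ tri k)   ≈⟨ sign-σ (suc k ℕ.+ tri k) ⟩
    σ (suc k ℕ.+ tri k)        ≈⟨ σ-+ (suc k) (tri k) ⟩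
    σ (suc k) * σ (tri k)      ≈⟨ *-cong (σ-even (suc k) (≡.trans (isEven-suc k) (≡.cong not e))) (sym (sign-σ (tri k))) ⟩
    1# * sign R (tri k)        ≈⟨ *-identityˡ _ ⟩
    sign R (tri k)             ∎)

  cullisFormula-pfaffian : ∀ n k (X : Fin n → Fin k → Carrier) → PfaffianIdentity R n k (cullisFormula R n k X) X
  cullisFormula-pfaffian n k X =
      (λ ek → trans (cullisFormula-minorSum n k X) (*-congˡ (minorSum-pf k X ek)))
    , (λ ek en → trans (cullisFormula-minorSum n k X) (*-cong (sign-tri-suc k ek) (begin
        minorSum X (allFin k)                ≈⟨ minorSum-X′ X ek en ⟨
        minorSum (X′ R X) (allFin (suc k))   ≈⟨ minorSum-pf (suc k) (X′ R X) (even-suc ek) ⟩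
        pf R (gram R (X′ R X))               ∎)))
    , (λ ek en → trans (cullisFormula-minorSum n k X) (*-cong (sign-tri-suc k ek) (begin
        minorSum X (allFin k)
          ≈⟨ minorSum-zeroRow X (allFin k) ⟨
        minorSum (zeroRow X) (allFin k)
          ≈⟨ minorSum-X′ (zeroRow X) ek (≡.trans (isEven-suc n) (≡.cong not en)) ⟨
        minorSum (X′ R (zeroRow X)) (allFin (suc k))
          ≈⟨ minorSum-cong (λ i j → reflexive (X″-zeroRow X i j)) (allFin (suc k)) ⟩
        minorSum (X″ R X) (allFin (suc k))
          ≈⟨ minorSum-pf (suc k) (X″ R X) (even-suc ek) ⟩
        pf R (gram R (X″ R X)) ∎)))
    where
    even-suc : isEven k ≡ false → isEven (suc k) ≡ true
    even-suc e = ≡.trans (isEven-suc k) (≡.cong not e)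

  cullis-formula : ∀ n k (X : Fin n → Fin k → Carrier) → k ≤ n → cullis R n k X ≡ cullisFormula R n k X
  cullis-formula n k X k≤n with k ≤? n
  ... | yes _   = ≡.refl
  ... | no  k≰n = contradiction k≤n k≰n

  cullis-pfaffian : ∀ n k (X : Fin n → Fin k → Carrier) → k ≤ n → PfaffianIdentity R n k (cullis R n k X) X
  cullis-pfaffian n k X k≤n = ≡.subst (λ d → PfaffianIdentity R n k d X)
    (≡.sym (cullis-formula n k X k≤n)) (cullisFormula-pfaffian n k X)

theorem1 : ∀ {c ℓ} (R : CommutativeRing c ℓ) (n k : ℕ) → 1 ≤ n → 1 ≤ k →
    (X : Mat R n k) →
    (k ≤ n → PfaffianIdentity R n k (cullis R n k X) X)
    × (n < k → PfaffianIdentity R k n (cullis R k n (transpose R X)) (transpose R X))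
theorem1 R n k _ _ X =
    MatchingSum.cullis-pfaffian R n k X
  , (λ n<k → MatchingSum.cullis-pfaffian R k n (transpose R X) (<⇒≤ n<k))
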